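{- For every planar graph $G$, $\chi^\star_c(G)\le 8$.
   Context: Graphs are finite and simple. For a positive integer $k$, a $k$-cover (or $k$-correspondence assignment) of a graph $G$ is a pair $(\vec D,\sigma)$ where $\vec D$ is an orientation of $G$ and $\sigma$ assigns to each arc of $\vec D$ a permutation of $[k]=\{1,\dots,k\}$. A $(\vec D,\sigma)$-coloring is a map $\varphi:V(G)\to[k]$ with $\sigma(vw)(\varphi(v))\ne\varphi(w)$ for every arc $vw$ of $\vec D$. A $(\vec D,\sigma)$-packing is a collection $\varphi_1,\dots,\varphi_k$ of $(\vec D,\sigma)$-colorings such that $\varphi_i(v)\ne\varphi_j(v)$ for every vertex $v$ and all distinct $i,j\in[k]$. The correspondence packing number $\chi^\star_c(G)$ is the minimum $k$ such that $G$ has a $(\vec D,\sigma)$-packing for every $k$-cover $(\vec D,\sigma)$ of $G$. -}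

module Defs where

open import Data.Nat using (ℕ; _+_; _*_; _≤_)
open import Data.Bool using (Bool; true; false; if_then_else_)
open import Data.Fin using (Fin)
open import Data.Fin.Permutation using (Permutation′; _⟨$⟩ʳ_)
open import Data.List using (List; map; allFin)
open import Data.Bool.ListAction using (any)
open import Data.Nat.ListAction using (sum)
open import Data.Product using (Σ; ∃; _×_)
open import Data.Sum using (_⊎_)
open import Relation.Binary.PropositionalEquality using (_≡_; _≢_)
open import Relation.Binary.Construct.Closure.ReflexiveTransitive using (Star)
open import Function.Bundles using (_⇔_)

record Graph : Set where
  field
    n     : ℕ
    adj   : Fin n → Fin n → Bool
    sym   : ∀ u v → adj u v ≡ adj v u
    irrefl : ∀ u → adj u u ≡ false

module _ (G : Graph) where
  open Graph G

  Adj : Fin n → Fin n → Set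
  Adj u v = adj u v ≡ true

  Connected : Fin n → Fin n → Set
  Connected = Star Adj

  hasNeighbour : Fin n → Bool
  hasNeighbour u = any (adj u) (allFin n)

  isolatedCount : ℕ
  isolatedCount = sum (map (λ u → if hasNeighbour u then 0 else 1) (allFin n))

  -- Planarity, via combinatorial embeddings (rotation systems).
  -- Darts (Fin m) are in bijection with ordered pairs (u , v) of adjacent
  -- vertices: tail d = u, tail (rev d) = v.  rot is the rotation: it
  -- permutes the darts at each vertex in a single cycle.  Faces are the
  -- orbits of d ↦ rot (rev d).  The embedding is in the sphere iff
  -- Euler's formula holds: each component with an edge has
  -- V - E + F = 2, and each isolated vertex has V - E + F = 1 (no darts),
  -- i.e.  n - E + F = 2c - i  with  m = 2E; written without subtraction as
  -- 2 (n + F + i) = 4c + m.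

  record PlanarEmbedding : Set where
    field
      m      : ℕ
      tail   : Fin m → Fin n
      rev    : Fin m → Fin m
      rev-invol : ∀ d → rev (rev d) ≡ d
      dart-adj  : ∀ d → Adj (tail d) (tail (rev d))
      dart-surj : ∀ u v → Adj u v → Σ (Fin m) λ d → tail d ≡ u × tail (rev d) ≡ v
      dart-inj  : ∀ d d' → tail d ≡ tail d' → tail (rev d) ≡ tail (rev d') → d ≡ d'
      rot       : Permutation′ m
      rot-tail  : ∀ d → tail (rot ⟨$⟩ʳ d) ≡ tail d
      rot-cycle : ∀ d d' → tail d ≡ tail d' → Star (λ x y → rot ⟨$⟩ʳ x ≡ y) d d'
      F      : ℕ
      face   : Fin m → Fin F
      face-surj : ∀ f → Σ (Fin m) λ d → face d ≡ f
      face-orbit : ∀ d d' → (face d ≡ face d') ⇔ Star (λ x y → rot ⟨$⟩ʳ (rev x) ≡ y) d d'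
      c      : ℕ
      comp   : Fin n → Fin c
      comp-surj : ∀ k → Σ (Fin n) λ u → comp u ≡ k
      comp-conn : ∀ u v → (comp u ≡ comp v) ⇔ Connected u v
      euler  : 2 * (n + F + isolatedCount) ≡ 4 * c + m

  Planar : Set
  Planar = PlanarEmbedding

  record Orientation : Set where
    field
      arc       : Fin n → Fin n → Bool
      arc-adj   : ∀ u v → arc u v ≡ true → Adj u v
      adj-arc   : ∀ u v → Adj u v → arc u v ≡ true ⊎ arc v u ≡ true
      arc-asym  : ∀ u v → arc u v ≡ true → arc v u ≡ false

  -- a k-cover (D , σ); σ is given on all ordered pairs but only its
  -- values on arcs of D are ever used
  record Cover (k : ℕ) : Set where
    field
      D : Orientation
      σ : Fin n → Fin n → Permutation′ k

  module _ {k : ℕ} (C : Cover k) where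
    open Cover C
    open Orientation D

    IsColoring : (Fin n → Fin k) → Set
    IsColoring φ = ∀ v w → arc v w ≡ true → σ v w ⟨$⟩ʳ φ v ≢ φ w

    Packing : Set
    Packing = Σ (Fin k → Fin n → Fin k) λ φs →
                (∀ i → IsColoring (φs i)) ×
                (∀ v i j → i ≢ j → φs i v ≢ φs j v)

  PackableFor : ℕ → Set
  PackableFor k = (C : Cover k) → Packing C

  -- χ*_c(G) ≤ b  : the minimum positive k with PackableFor k is at most b
  χc⋆≤ : ℕ → Set
  χc⋆≤ b = Σ ℕ λ k → 1 ≤ k × k ≤ b × PackableFor k

{-# OPTIONS --safe #-}
module Submission where

-- The packing is built vertex by vertex on vertex sets W.  Given the colours of the neighbours, the
-- colours of a vertex in the eight colourings form a perfect matching in K₈,₈ minus one perfect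
-- matching per coloured neighbour.  If u has at most four neighbours in W, Hall's condition holds.
-- Otherwise W contains an edge uv with deg u ≤ 5 and deg v ≤ 6 (Wernicke's theorem).  Given a packing
-- of W ∖ u, keep everything except the colours of v: one needs disjoint perfect matchings in a graph
-- A of minimum degree 4 (for u) and in a graph B of minimum degree 3 that has a perfect matching (for
-- v).  A matching M of B is an obstacle only if M contains all edges of A in some block S × T with
-- |S| + |T| ≥ 9; any two such blocks of A share most of these edges, whereas some matching of B omits
-- two of them.
--
-- Wernicke's theorem for induced subgraphs follows from Euler's inequality, which survives edge
-- deletions, by giving the corners of the faces the charge 35 (1 - 6 / deg) plus a share of the face.

open import Data.Bool using (Bool; true; false; _∧_; _∨_; not; if_then_else_)
open import Data.Bool.Properties using (∧-zeroʳ; T-≡)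
open import Data.Empty using (⊥; ⊥-elim)
open import Data.Fin using (Fin; zero; suc)
import Data.Fin as Fin
open import Data.Fin.Permutation using (Permutation′; _⟨$⟩ʳ_; _⟨$⟩ˡ_; _∘ₚ_; transpose; permutation; inverseˡ; inverseʳ)
import Data.Fin.Properties as Fin
open import Data.List using ([]; _∷_; map; allFin; tabulate)
open import Data.List.Membership.Propositional using (lose)
open import Data.List.Membership.Propositional.Properties using (∈-allFin)
open import Data.List.Properties using (map-tabulate)
open import Data.List.Relation.Unary.Any.Properties using (any⁺)
open import Data.Maybe using (Maybe; just; nothing)
import Data.Maybe as Maybe
open import Data.Nat using (ℕ; zero; suc; _+_; _*_; _∸_; _≤_; _<_; z≤n; s≤s)
import Data.Nat.ListAction as ListAction
open import Data.Nat.Properties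
open import Data.Nat.Tactic.RingSolver using (solve)
open import Data.Product using (Σ; ∃; _×_; _,_; proj₁; proj₂)
open import Data.Sum using (_⊎_; inj₁; inj₂; [_,_]′)
open import Function using (_∘_; id; case_of_; flip)
open import Function.Bundles using (Equivalence)
open import Relation.Binary.Construct.Closure.ReflexiveTransitive using (Star; ε; _◅_; _◅◅_)
import Relation.Binary.Construct.Closure.ReflexiveTransitive as Star
open import Relation.Binary.PropositionalEquality
open import Relation.Nullary using (¬_; Dec; yes; no; does)
open import Relation.Nullary.Decidable using (dec-true; dec-false; ¬¬-excluded-middle)
open import Algebra.Properties.CommutativeMonoid.Sum +-0-commutativeMonoid using (sum; sum-cong-≗; ∑-distrib-+; ∑-comm; ∑-permute)
open import Defs

-- The number 8 enters through Hall's theorem: in a bipartite graph on 8 + 8 vertices minimum degree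
-- 4 forces a perfect matching, while minimum degree 3 does not. A planar graph may have all degrees
-- at least 5, and five coloured neighbours leave the new vertex only degree 3. So a neighbour v has
-- to move together with u: without the edge uv, the degrees are 8 - 4 at u and 8 - 5 at v. Degree 3
-- at v still promises nothing by itself, which is why the packing of the smaller graph contains v:
-- the colours that v already has are the first matching, and it only has to be perturbed.
--
-- Euler's formula is kept one-sided. The number c may exceed the number of components and F may
-- fall short of the number of faces; both deviations strengthen the inequality, so no exact recount
-- of faces or components is needed after a deletion.
--
-- In the charges, 35 = 5 · 7 clears the denominators of 35 (1 - 6/k) at the critical degrees k = 5,
-- 6, 7, and the shift by 7 turns the values there into 0, 7, 12.

private variable
  n m k : ℕ

-- Finite sums and counting

false≢true : ∀ {b} → b ≡ false → b ≡ true → ⊥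
false≢true refl ()

≢true⇒false : ∀ {b} → (b ≡ true → ⊥) → b ≡ false
≢true⇒false {false} _ = refl
≢true⇒false {true} h = ⊥-elim (h refl)

∧-intro : ∀ {a b} → a ≡ true → b ≡ true → a ∧ b ≡ true
∧-intro refl refl = refl

∧-projₗ : ∀ {a b} → a ∧ b ≡ true → a ≡ true
∧-projₗ {true} _ = refl

∧-projᵣ : ∀ {a b} → a ∧ b ≡ true → b ≡ true
∧-projᵣ {true} h = h

∨-introₗ : ∀ {a b} → a ≡ true → a ∨ b ≡ true
∨-introₗ refl = refl

∨-introᵣ : ∀ {a b} → b ≡ true → a ∨ b ≡ true
∨-introᵣ {true} _ = refl
∨-introᵣ {false} h = h

∨-elim : ∀ {a b} → a ∨ b ≡ true → a ≡ true ⊎ b ≡ true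
∨-elim {true} _ = inj₁ refl
∨-elim {false} h = inj₂ h

not-intro : ∀ {a} → a ≡ false → not a ≡ true
not-intro refl = refl

not-elim : ∀ {a} → not a ≡ true → a ≡ false
not-elim {false} _ = refl

bool-cases : ∀ b → b ≡ true ⊎ b ≡ false
bool-cases true = inj₁ refl
bool-cases false = inj₂ refl

does-true : ∀ {A : Set} (a? : Dec A) → does a? ≡ true → A
does-true (yes a) _ = a

infix 5 _==_
opaque
  _==_ : Fin n → Fin n → Bool
  i == j = does (i Fin.≟ j)

  ==⇒≡ : ∀ {i j : Fin n} → (i == j) ≡ true → i ≡ j
  ==⇒≡ {i = i} {j} = does-true (i Fin.≟ j)

  ≡⇒== : ∀ {i j : Fin n} → i ≡ j → (i == j) ≡ true
  ≡⇒== {i = i} {j} = dec-true (i Fin.≟ j)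

  ≢⇒== : ∀ {i j : Fin n} → i ≢ j → (i == j) ≡ false
  ≢⇒== {i = i} {j} = dec-false (i Fin.≟ j)

==-false : ∀ {i j : Fin n} → (i == j) ≡ false → i ≢ j
==-false h p = false≢true h (≡⇒== p)

search : (P : Fin n → Bool) → (∃ λ i → P i ≡ true) ⊎ (∀ i → P i ≡ false)
search {zero} P = inj₂ λ ()
search {suc n} P with bool-cases (P zero) | search (P ∘ suc)
... | inj₁ h | _ = inj₁ (zero , h)
... | inj₂ _ | inj₁ (i , h) = inj₁ (suc i , h)
... | inj₂ h | inj₂ hs = inj₂ λ { zero → h ; (suc i) → hs i }

opaque
  some : (Fin n → Bool) → Bool
  some P = [ (λ _ → true) , (λ _ → false) ]′ (search P)

  some-intro : ∀ {P : Fin n → Bool} i → P i ≡ true → some P ≡ true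
  some-intro {P = P} i h with search P
  ... | inj₁ _ = refl
  ... | inj₂ f = ⊥-elim (false≢true (f i) h)

  some-elim : ∀ {P : Fin n → Bool} → some P ≡ true → ∃ λ i → P i ≡ true
  some-elim {P = P} h with search P
  ... | inj₁ p = p
  ... | inj₂ _ with () ← h

findOrAll : {A B : Fin n → Set} → (∀ i → A i ⊎ B i) → ∃ A ⊎ (∀ i → B i)
findOrAll {zero} h = inj₂ λ ()
findOrAll {suc n} h with h zero | findOrAll (h ∘ suc)
... | inj₁ a | _ = inj₁ (zero , a)
... | inj₂ _ | inj₁ (i , a) = inj₁ (suc i , a)
... | inj₂ b | inj₂ bs = inj₂ λ { zero → b ; (suc i) → bs i }

∑-mono : {f g : Fin n → ℕ} → (∀ i → f i ≤ g i) → sum f ≤ sum g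
∑-mono {zero} h = z≤n
∑-mono {suc n} h = +-mono-≤ (h zero) (∑-mono (h ∘ suc))

∑-tight : {f g : Fin n → ℕ} → (∀ i → f i ≤ g i) → sum g ≤ sum f → ∀ i → g i ≤ f i
∑-tight {suc n} {f} {g} h le zero =
  +-cancelʳ-≤ (sum (g ∘ suc)) (g zero) (f zero)
    (≤-trans le (+-monoʳ-≤ (f zero) (∑-mono (h ∘ suc))))
∑-tight {suc n} {f} {g} h le (suc i) =
  ∑-tight (h ∘ suc)
    (+-cancelˡ-≤ (g zero) _ _ (≤-trans le (+-monoˡ-≤ (sum (f ∘ suc)) (h zero)))) i

∑-const : ∀ c → sum {n} (λ _ → c) ≡ n * c
∑-const {zero} c = refl
∑-const {suc n} c = cong (c +_) (∑-const {n} c)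

∑-*ˡ : ∀ c (f : Fin n → ℕ) → sum (λ i → c * f i) ≡ c * sum f
∑-*ˡ {zero} c f = sym (*-zeroʳ c)
∑-*ˡ {suc n} c f = trans (cong (c * f zero +_) (∑-*ˡ c (f ∘ suc))) (sym (*-distribˡ-+ c (f zero) _))

term≤∑ : ∀ (f : Fin n → ℕ) i → f i ≤ sum f
term≤∑ f zero = m≤m+n _ _
term≤∑ f (suc i) = ≤-trans (term≤∑ (f ∘ suc) i) (m≤n+m _ _)

⟦_⟧ : Bool → ℕ
⟦ b ⟧ = if b then 1 else 0

⟦⟧≤1 : ∀ b → ⟦ b ⟧ ≤ 1
⟦⟧≤1 true = s≤s z≤n
⟦⟧≤1 false = z≤n

⟦⟧-mono : ∀ {a b} → (a ≡ true → b ≡ true) → ⟦ a ⟧ ≤ ⟦ b ⟧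
⟦⟧-mono {false} h = z≤n
⟦⟧-mono {true} h rewrite h refl = s≤s z≤n

opaque
  count : (Fin n → Bool) → ℕ
  count P = sum (λ i → ⟦ P i ⟧)

  count-def : (P : Fin n → Bool) → count P ≡ sum (λ i → ⟦ P i ⟧)
  count-def P = refl

  count-mono : {P Q : Fin n → Bool} → (∀ i → P i ≡ true → Q i ≡ true) → count P ≤ count Q
  count-mono h = ∑-mono (λ i → ⟦⟧-mono (h i))

  count-cong : {P Q : Fin n → Bool} → (∀ i → P i ≡ Q i) → count P ≡ count Q
  count-cong h = sum-cong-≗ (λ i → cong ⟦_⟧ (h i))

  count-≤n : (P : Fin n → Bool) → count P ≤ n
  count-≤n {n} P = ≤-trans (∑-mono (λ i → ⟦⟧≤1 (P i))) (≤-reflexive (trans (∑-const {n} 1) (*-identityʳ n)))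

  count-full : count {n} (λ _ → true) ≡ n
  count-full {n} = trans (∑-const {n} 1) (*-identityʳ n)

  count-∧∨ : (P Q : Fin n → Bool) → count (λ i → P i ∧ Q i) + count (λ i → P i ∨ Q i) ≡ count P + count Q
  count-∧∨ P Q = begin
    count (λ i → P i ∧ Q i) + count (λ i → P i ∨ Q i)       ≡⟨ ∑-distrib-+ (λ i → ⟦ P i ∧ Q i ⟧) (λ i → ⟦ P i ∨ Q i ⟧) ⟨
    sum (λ i → ⟦ P i ∧ Q i ⟧ + ⟦ P i ∨ Q i ⟧)               ≡⟨ sum-cong-≗ (λ i → pointwise (P i) (Q i)) ⟩
    sum (λ i → ⟦ P i ⟧ + ⟦ Q i ⟧)                           ≡⟨ ∑-distrib-+ (λ i → ⟦ P i ⟧) (λ i → ⟦ Q i ⟧) ⟩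
    count P + count Q                                       ∎
    where
    open ≡-Reasoning
    pointwise : ∀ a b → ⟦ a ∧ b ⟧ + ⟦ a ∨ b ⟧ ≡ ⟦ a ⟧ + ⟦ b ⟧
    pointwise true b = +-comm ⟦ b ⟧ 1
    pointwise false b = refl

  count-split : (P Q : Fin n → Bool) → count P ≡ count (λ i → P i ∧ Q i) + count (λ i → P i ∧ not (Q i))
  count-split P Q = trans (sum-cong-≗ (λ i → pointwise (P i) (Q i))) (∑-distrib-+ (λ i → ⟦ P i ∧ Q i ⟧) (λ i → ⟦ P i ∧ not (Q i) ⟧))
    where
    pointwise : ∀ a b → ⟦ a ⟧ ≡ ⟦ a ∧ b ⟧ + ⟦ a ∧ not b ⟧
    pointwise true true = refl
    pointwise true false = refl
    pointwise false b = refl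

  count-empty : {P : Fin n → Bool} → (∀ i → P i ≡ false) → count P ≡ 0
  count-empty {n} h = trans (sum-cong-≗ (λ i → cong ⟦_⟧ (h i))) (trans (∑-const {n} 0) (*-zeroʳ n))

  count-member : ∀ {P : Fin n → Bool} i → P i ≡ true → 1 ≤ count P
  count-member {P = P} i h = ≤-trans (≤-reflexive (sym (cong ⟦_⟧ h))) (term≤∑ (λ i → ⟦ P i ⟧) i)

  count-≤1 : {P : Fin n → Bool} → (∀ i j → P i ≡ true → P j ≡ true → i ≡ j) → count P ≤ 1
  count-≤1 {zero} u = z≤n
  count-≤1 {suc n} {P} u with bool-cases (P zero)
  ... | inj₂ h = ≤-trans (≤-reflexive (cong (λ b → ⟦ b ⟧ + count (P ∘ suc)) h))
                   (count-≤1 (λ i j p q → Fin.suc-injective (u (suc i) (suc j) p q)))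
  ... | inj₁ h = ≤-trans (≤-reflexive (cong (⟦ P zero ⟧ +_) (count-empty {P = P ∘ suc} rest)))
                   (≤-trans (≤-reflexive (+-identityʳ _)) (⟦⟧≤1 (P zero)))
    where
    rest : ∀ i → P (suc i) ≡ false
    rest i = ≢true⇒false (λ q → case u zero (suc i) h q of λ ())

  -- Double counting of related pairs: every i in Q has at least one partner, every j in J at most
  -- one. A relation instead of a map spares the choice of partners.
  count-relation : (Q : Fin n → Bool) (J : Fin m → Bool) (R : Fin n → Fin m → Bool) →
    (∀ i → Q i ≡ true → ∃ λ j → J j ≡ true × R i j ≡ true) →
    (∀ j i i′ → J j ≡ true → Q i ≡ true → Q i′ ≡ true → R i j ≡ true → R i′ j ≡ true → i ≡ i′) →
    count Q ≤ count J
  count-relation Q J R total unique = begin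
    count Q                                                 ≤⟨ ∑-mono row ⟩
    sum (λ i → sum (λ j → ⟦ J j ∧ (Q i ∧ R i j) ⟧))         ≡⟨ ∑-comm (λ i j → ⟦ J j ∧ (Q i ∧ R i j) ⟧) ⟩
    sum (λ j → sum (λ i → ⟦ J j ∧ (Q i ∧ R i j) ⟧))         ≤⟨ ∑-mono col ⟩
    count J                                                 ∎
    where
    open ≤-Reasoning
    row : ∀ i → ⟦ Q i ⟧ ≤ count (λ j → J j ∧ (Q i ∧ R i j))
    row i with bool-cases (Q i)
    ... | inj₂ h = ≤-trans (≤-reflexive (cong ⟦_⟧ h)) z≤n
    ... | inj₁ h with total i h
    ... | j , jj , r = ≤-trans (⟦⟧≤1 (Q i)) (count-member j (∧-intro jj (∧-intro h r)))
    col : ∀ j → count (λ i → J j ∧ (Q i ∧ R i j)) ≤ ⟦ J j ⟧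
    col j with bool-cases (J j)
    ... | inj₂ h = ≤-reflexive (trans (count-empty (λ i → cong (_∧ (Q i ∧ R i j)) h)) (sym (cong ⟦_⟧ h)))
    ... | inj₁ h = ≤-trans
        (count-≤1 (λ i i′ p p′ → unique j i i′ h
          (∧-projₗ (∧-projᵣ {J j} p)) (∧-projₗ (∧-projᵣ {J j} p′))
          (∧-projᵣ {Q i} (∧-projᵣ {J j} p)) (∧-projᵣ {Q i′} (∧-projᵣ {J j} p′))))
        (≤-reflexive (sym (cong ⟦_⟧ h)))

count-not : (P : Fin n → Bool) → count P + count (not ∘ P) ≡ n
count-not {n} P = trans (sym (count-split (λ _ → true) P)) (count-full {n})

count-∨-≤ : (P Q : Fin n → Bool) → count (λ i → P i ∨ Q i) ≤ count P + count Q
count-∨-≤ P Q = ≤-trans (m≤n+m _ _) (≤-reflexive (count-∧∨ P Q))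

count-disjoint : (P Q : Fin n → Bool) → (∀ i → P i ≡ true → Q i ≡ true → ⊥) →
  count P + count Q ≡ count (λ i → P i ∨ Q i)
count-disjoint P Q dis = trans (sym (count-∧∨ P Q))
  (cong (_+ count (λ i → P i ∨ Q i)) (count-empty (λ i → ≢true⇒false (λ h → dis i (∧-projₗ h) (∧-projᵣ {P i} h)))))

count-pos : ∀ (P : Fin n → Bool) → 1 ≤ count P → ∃ λ i → P i ≡ true
count-pos P le with search P
... | inj₁ x = x
... | inj₂ h = ⊥-elim (<-irrefl refl (≤-trans le (≤-reflexive (count-empty h))))

infixl 6 _∖_
_∖_ : (Fin n → Bool) → Fin n → Fin n → Bool
(P ∖ x) i = P i ∧ not (i == x)

∖-intro : ∀ {P : Fin n → Bool} {x i} → P i ≡ true → i ≢ x → (P ∖ x) i ≡ true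
∖-intro p ne = ∧-intro p (not-intro (≢⇒== ne))

∖-≢ : ∀ {P : Fin n → Bool} {x i} → (P ∖ x) i ≡ true → i ≢ x
∖-≢ {P = P} {i = i} h = ==-false (not-elim (∧-projᵣ {P i} h))

count-single : (x : Fin n) → count (λ i → i == x) ≡ 1
count-single x = ≤-antisym (count-≤1 (λ i j p q → trans (==⇒≡ p) (sym (==⇒≡ q)))) (count-member x (≡⇒== refl))

count-∖ : ∀ (P : Fin n → Bool) x → P x ≡ true → count P ≡ suc (count (P ∖ x))
count-∖ P x h = trans (count-split P (λ i → i == x)) (cong (_+ count (P ∖ x)) (trans (count-cong at-x) (count-single x)))
  where
  at-x : ∀ i → (P i ∧ (i == x)) ≡ (i == x)
  at-x i with bool-cases (i == x)
  ... | inj₁ e = trans (cong₂ _∧_ (trans (cong P (==⇒≡ e)) h) e) (sym e)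
  ... | inj₂ e = trans (cong (P i ∧_) e) (trans (∧-zeroʳ (P i)) (sym e))

count-∖-≤ : ∀ (P : Fin n → Bool) x → count P ≤ suc (count (P ∖ x))
count-∖-≤ P x with bool-cases (P x)
... | inj₁ h = ≤-reflexive (count-∖ P x h)
... | inj₂ h = m≤n⇒m≤1+n (count-mono (λ i p → ∖-intro {P = P} p (λ e → false≢true h (subst (λ z → P z ≡ true) e p))))

opaque
  -- Certificate for linear arithmetic: the hypotheses, with multiplicities, are added up to l ≤ r,
  -- and the ring solver checks that l exceeds r by k + 1.
  linear-⊥ : ∀ {l r} k → l ≤ r → l ≡ suc (k + r) → ⊥
  linear-⊥ {r = r} k le refl = <-irrefl refl (≤-trans (s≤s (m≤n+m r k)) le)

-- Hall's theorem

Matrix : ℕ → Set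
Matrix n = Fin n → Fin n → Bool

IsPerfectMatching : Matrix n → (Fin n → Fin n) → Set
IsPerfectMatching E f = (∀ {i j} → f i ≡ f j → i ≡ j) × (∀ i → E i (f i) ≡ true)

PerfectMatching : Matrix n → Set
PerfectMatching E = Σ _ (IsPerfectMatching E)

EmptyBlock : Matrix n → (S T : Fin n → Bool) → Set
EmptyBlock E S T = ∀ i j → S i ≡ true → T j ≡ true → E i j ≡ false

HallViolator : Matrix n → Set
HallViolator {n} E = Σ (Fin n → Bool) λ S → Σ (Fin n → Bool) λ T → EmptyBlock E S T × n < count S + count T

edges : Matrix n → ℕ
edges E = sum (λ i → count (E i))

deleteEdge : Matrix n → Fin n → Fin n → Matrix n
deleteEdge E a b i j = E i j ∧ not ((i == a) ∧ (j == b))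

deleteEdge-⊆ : ∀ (E : Matrix n) {a b i j} → deleteEdge E a b i j ≡ true → E i j ≡ true
deleteEdge-⊆ E = ∧-projₗ

deleteEdge-≢ : ∀ (E : Matrix n) {a b j} → deleteEdge E a b a j ≡ true → j ≢ b
deleteEdge-≢ E {a} {b} {j} h e =
  false≢true (not-elim (∧-projᵣ {E a j} h)) (∧-intro (≡⇒== refl) (≡⇒== e))

deleteEdge-intro : ∀ (E : Matrix n) {a b i j} → E i j ≡ true → (i ≡ a → j ≡ b → ⊥) → deleteEdge E a b i j ≡ true
deleteEdge-intro E e ne = ∧-intro e (not-intro (≢true⇒false (λ h → ne (==⇒≡ (∧-projₗ h)) (==⇒≡ (∧-projᵣ h)))))

deleteEdge-false : ∀ (E : Matrix n) {a b i j} → deleteEdge E a b i j ≡ false → (i ≡ a → j ≡ b → ⊥) → E i j ≡ false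
deleteEdge-false E h ne = ≢true⇒false (λ e → false≢true h (deleteEdge-intro E e ne))

deleteEdge-hit : ∀ (E : Matrix n) {a b i j} → deleteEdge E a b i j ≡ false → E i j ≡ true → i ≡ a × j ≡ b
deleteEdge-hit E {a} {b} {i} {j} h e with bool-cases ((i == a) ∧ (j == b))
... | inj₁ eq = ==⇒≡ (∧-projₗ eq) , ==⇒≡ (∧-projᵣ {i == a} eq)
... | inj₂ ne = ⊥-elim (false≢true h (∧-intro e (not-intro ne)))

edges-delete : ∀ (E : Matrix n) {a b} → E a b ≡ true → edges (deleteEdge E a b) < edges E
edges-delete {n} E {a} {b} e = ≰⇒> λ le →
  <-irrefl refl (<-≤-trans (row-a) (∑-tight rows le a))
  where
  rows : ∀ i → count (deleteEdge E a b i) ≤ count (E i)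
  rows i = count-mono (λ j → deleteEdge-⊆ E)
  row-a : count (deleteEdge E a b a) < count (E a)
  row-a = ≤-trans (s≤s (count-mono (λ j h → ∖-intro {P = E a} (deleteEdge-⊆ E h) (deleteEdge-≢ E h))))
            (≤-reflexive (sym (count-∖ (E a) b e)))

-- Two violators of E minus an edge, for two edges in the same row i, uncross: one of the pairs
-- (S₁ ∪ S₂ , T₁ ∩ T₂) and (S₁ ∩ S₂ ∖ i , T₁ ∪ T₂) violates Hall's condition for E itself.
uncross-violators : ∀ (E : Matrix n) {i j₁ j₂} → j₁ ≢ j₂ →
  HallViolator (deleteEdge E i j₁) → HallViolator (deleteEdge E i j₂) → HallViolator E
uncross-violators {n} E {i} {j₁} {j₂} j₁≢j₂ (S₁ , T₁ , empty₁ , big₁) (S₂ , T₂ , empty₂ , big₂)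
  with bool-cases (S₁ i ∧ T₁ j₁) | bool-cases (S₂ i ∧ T₂ j₂)
... | inj₂ out | _ = S₁ , T₁ , (λ a b s t → deleteEdge-false E (empty₁ a b s t)
        (λ { refl refl → false≢true out (∧-intro s t) })) , big₁
... | inj₁ _ | inj₂ out = S₂ , T₂ , (λ a b s t → deleteEdge-false E (empty₂ a b s t)
        (λ { refl refl → false≢true out (∧-intro s t) })) , big₂
... | inj₁ in₁ | inj₁ in₂ = choose
  where
  ∪S ∩S ∪T ∩T : Fin n → Bool
  ∪S a = S₁ a ∨ S₂ a
  ∩S a = S₁ a ∧ S₂ a
  ∪T b = T₁ b ∨ T₂ b
  ∩T b = T₁ b ∧ T₂ b

  -- An entry of `E` here lies in one of the two blocks, so it is (i , j₁) or (i , j₂). As row i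
  -- belongs to S₁ and S₂ and the column to T₁ and T₂, it lies in the other block too and would have
  -- to be both.
  empty-∪∩ : EmptyBlock E ∪S ∩T
  empty-∪∩ a b s t = ≢true⇒false λ e → [ (λ s₁ → inside₁ s₁ e) , (λ s₂ → inside₂ s₂ e) ]′ (∨-elim {S₁ a} s)
    where
    t₁ : T₁ b ≡ true
    t₁ = ∧-projₗ t
    t₂ : T₂ b ≡ true
    t₂ = ∧-projᵣ {T₁ b} t
    inside₁ : S₁ a ≡ true → E a b ≡ true → ⊥
    inside₁ s₁ e with refl , refl ← deleteEdge-hit E (empty₁ a b s₁ t₁) e =
      j₁≢j₂ (proj₂ (deleteEdge-hit E (empty₂ a b (∧-projₗ in₂) t₂) e))
    inside₂ : S₂ a ≡ true → E a b ≡ true → ⊥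
    inside₂ s₂ e with refl , refl ← deleteEdge-hit E (empty₂ a b s₂ t₂) e =
      j₁≢j₂ (sym (proj₂ (deleteEdge-hit E (empty₁ a b (∧-projₗ in₁) t₁) e)))

  empty-∩∪ : EmptyBlock E (∩S ∖ i) ∪T
  empty-∩∪ a b s t = [ (λ t₁ → deleteEdge-false E (empty₁ a b (∧-projₗ s′) t₁) (λ a≡i _ → ∖-≢ {P = ∩S} s a≡i))
                     , (λ t₂ → deleteEdge-false E (empty₂ a b (∧-projᵣ {S₁ a} s′) t₂) (λ a≡i _ → ∖-≢ {P = ∩S} s a≡i)) ]′
                     (∨-elim {T₁ b} t)
    where
    s′ : ∩S a ≡ true
    s′ = ∧-projₗ s

  -- The two violators exceed 2n by at least two in total, and taking row i out of the intersection
  -- costs only one.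
  arith : ∀ s₁ s₂ t₁ t₂ si s∪ t∩ t∪ → n < s₁ + t₁ → n < s₂ + t₂ → suc si + s∪ ≡ s₁ + s₂ → t∩ + t∪ ≡ t₁ + t₂ →
    s∪ + t∩ ≤ n → si + t∪ ≤ n → ⊥
  arith s₁ s₂ t₁ t₂ si s∪ t∩ t∪ b₁ b₂ eS eT le₁ le₂ =
    linear-⊥ 0 (+-mono-≤ (+-mono-≤ b₁ b₂) (+-mono-≤ (+-mono-≤ (≤-reflexive (sym eS)) (≤-reflexive (sym eT))) (+-mono-≤ le₁ le₂)))
      (solve (n ∷ s₁ ∷ s₂ ∷ t₁ ∷ t₂ ∷ si ∷ s∪ ∷ t∩ ∷ t∪ ∷ []))

  choose : HallViolator E
  choose with n <? count ∪S + count ∩T | n <? count (∩S ∖ i) + count ∪T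
  ... | yes big | _ = ∪S , ∩T , empty-∪∩ , big
  ... | no _ | yes big = (∩S ∖ i) , ∪T , empty-∩∪ , big
  ... | no small₁ | no small₂ = ⊥-elim (arith (count S₁) (count S₂) (count T₁) (count T₂) (count (∩S ∖ i)) (count ∪S) (count ∩T) (count ∪T) big₁ big₂
          (trans (cong (_+ count ∪S) (sym (count-∖ ∩S i (∧-intro (∧-projₗ {S₁ i} in₁) (∧-projₗ {S₂ i} in₂))))) (count-∧∨ S₁ S₂))
          (count-∧∨ T₁ T₂) (≮⇒≥ small₁) (≮⇒≥ small₂))

-- An empty row violates Hall's condition together with all columns; two rows that share their only
-- column violate it together with all other columns.
thin-hall : (E : Matrix n) → (∀ i j j′ → E i j ≡ true → E i j′ ≡ true → j ≡ j′) →
  PerfectMatching E ⊎ HallViolator E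
thin-hall {n} E thin with findOrAll (λ i → swap (search (E i)))
  where
  swap : ∀ {A B : Set} → A ⊎ B → B ⊎ A
  swap (inj₁ a) = inj₂ a
  swap (inj₂ b) = inj₁ b
... | inj₁ (i , none) = inj₂ ((λ a → a == i) , (λ _ → true) , (λ a b s _ → subst (λ z → E z b ≡ false) (sym (==⇒≡ s)) (none b)) ,
        ≤-reflexive (sym (cong₂ _+_ (count-single i) count-full)))
... | inj₂ nbr with findOrAll (λ i → search (λ i′ → not (i == i′) ∧ (proj₁ (nbr i) == proj₁ (nbr i′))))
... | inj₂ inj = inj₁ ((λ i → proj₁ (nbr i)) ,
        (λ {i} {j} e → injective i j e) , (λ i → proj₂ (nbr i)))
  where
  injective : ∀ i j → proj₁ (nbr i) ≡ proj₁ (nbr j) → i ≡ j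
  injective i j e with bool-cases (i == j)
  ... | inj₁ eq = ==⇒≡ eq
  ... | inj₂ ne = ⊥-elim (false≢true (inj i j) (∧-intro (not-intro ne) (≡⇒== e)))
... | inj₁ (i , i′ , clash) = inj₂ ((λ a → (a == i) ∨ (a == i′)) , (λ b → not (b == proj₁ (nbr i))) , empty , big)
  where
  c = proj₁ (nbr i)
  i≢i′ : i ≢ i′
  i≢i′ = ==-false (not-elim (∧-projₗ clash))
  same : c ≡ proj₁ (nbr i′)
  same = ==⇒≡ (∧-projᵣ {not (i == i′)} clash)
  empty : EmptyBlock E (λ a → (a == i) ∨ (a == i′)) (λ b → not (b == c))
  empty a b s t = ≢true⇒false λ e → ==-false (not-elim t) ([ (λ p → at-i (==⇒≡ p) e) , (λ p → at-i′ (==⇒≡ p) e) ]′ (∨-elim s))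
    where
    at-i : a ≡ i → E a b ≡ true → b ≡ c
    at-i refl e = thin a b c e (proj₂ (nbr a))
    at-i′ : a ≡ i′ → E a b ≡ true → b ≡ c
    at-i′ refl e = trans (thin a b (proj₁ (nbr a)) e (proj₂ (nbr a))) (sym same)
  big : n < count (λ a → (a == i) ∨ (a == i′)) + count (λ b → not (b == c))
  big = ≤-reflexive (sym (trans (cong (_+ count (λ b → not (b == c))) two) (cong suc one)))
    where
    two : count (λ a → (a == i) ∨ (a == i′)) ≡ 2
    two = trans (sym (count-disjoint (λ a → a == i) (λ a → a == i′) (λ a p q → i≢i′ (trans (sym (==⇒≡ p)) (==⇒≡ q)))))
            (cong₂ _+_ (count-single i) (count-single i′))
    one : suc (count (λ b → not (b == c))) ≡ n
    one = trans (cong (_+ count (λ b → not (b == c))) (sym (count-single c))) (count-not (λ b → b == c))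

-- Induction on the number of entries. When a row has two entries, each is deleted in turn: a
-- matching of either smaller matrix serves, and two violators uncross.
hall-bounded : ∀ k (E : Matrix n) → edges E < k → PerfectMatching E ⊎ HallViolator E
hall-bounded (suc k) E (s≤s le) with findOrAll (λ i → findOrAll (λ j → search (λ j′ → (E i j ∧ E i j′) ∧ not (j == j′))))
... | inj₂ thin = thin-hall E unique
  where
  unique : ∀ i j j′ → E i j ≡ true → E i j′ ≡ true → j ≡ j′
  unique i j j′ e e′ with bool-cases (j == j′)
  ... | inj₁ eq = ==⇒≡ eq
  ... | inj₂ ne = ⊥-elim (false≢true (thin i j j′) (∧-intro (∧-intro e e′) (not-intro ne)))
... | inj₁ (i , j , j′ , h) with hall-bounded k (deleteEdge E i j) (≤-trans (edges-delete E (∧-projₗ (∧-projₗ h))) le)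
                              | hall-bounded k (deleteEdge E i j′) (≤-trans (edges-delete E (∧-projᵣ {E i j} (∧-projₗ h))) le)
... | inj₁ (f , inj , sub) | _ = inj₁ (f , inj , λ i → deleteEdge-⊆ E (sub i))
... | inj₂ _ | inj₁ (f , inj , sub) = inj₁ (f , inj , λ i → deleteEdge-⊆ E (sub i))
... | inj₂ v | inj₂ v′ = inj₂ (uncross-violators E (==-false (not-elim (∧-projᵣ {E i j ∧ E i j′} h))) v v′)

opaque
  hall : (E : Matrix n) → PerfectMatching E ⊎ HallViolator E
  hall E = hall-bounded (suc (edges E)) E ≤-refl

-- Perfect matchings that avoid a diagonal entry

RowDegrees≥ : ℕ → Matrix n → Set
RowDegrees≥ d E = ∀ i → d ≤ count (E i)

-- What remains of minimum degree 3 after one entry is deleted; `unfix-two` applies `unfix-one` a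
-- second time in that situation.
ThreeButOneRow : Matrix n → Set
ThreeButOneRow E = RowDegrees≥ 2 E × (∀ i j → i ≢ j → 3 ≤ count (E i) ⊎ 3 ≤ count (E j))

-- Reading a matrix with true diagonal as a digraph, a separator witnesses that no cycle passes
-- through e, i.e. that every perfect matching contains the entry (e , e).
record Separator (B : Matrix n) (e : Fin n) : Set where
  field
    inside : Fin n → Bool
    closed : ∀ i j → inside i ≡ true → B i j ≡ true → inside j ≡ true
    avoids : inside e ≡ false
    nbrs   : ∀ j → B e j ≡ true → j ≢ e → inside j ≡ true

open Separator

module _ {B : Matrix n} where

  -- The complement of a closed set is closed under reversed arcs. Removing e from it is safe: a
  -- reversed arc into e comes from an out-neighbour of e, and those lie inside.
  dual : ∀ {e} → Separator B e → Separator (flip B) e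
  dual {e} s .inside i = not (inside s i) ∧ not (i == e)
  dual {e} s .closed j i w b =
    ∧-intro (not-intro (≢true⇒false (λ u → false≢true (not-elim (∧-projₗ w)) (closed s i j u b))))
            (not-intro (≢⇒== (λ { refl → false≢true (not-elim (∧-projₗ w))
              (nbrs s j b (==-false (not-elim (∧-projᵣ {not (inside s j)} w)))) })))
  dual {e} s .avoids = trans (cong (λ b → not (inside s e) ∧ not b) (≡⇒== refl)) (∧-zeroʳ (not (inside s e)))
  dual {e} s .nbrs i b i≢e = ∧-intro (not-intro (≢true⇒false (λ u → false≢true (avoids s) (closed s i e u b))))
                                     (not-intro (≢⇒== i≢e))

  Separators : (Fin n → Bool) → Set
  Separators P = ∀ e → P e ≡ true → Separator B e

  DisjointSeparator : (Fin n → Bool) → Set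
  DisjointSeparator P = Σ (Fin n) λ e → P e ≡ true × Σ (Separator B e) λ s → ∀ i → inside s i ≡ true → P i ≡ true → ⊥

  -- If some f in P lies inside, the intersection with the separator of f is a separator of f:
  -- closedness keeps the out-neighbours of f, while f itself drops out, so the size falls.
  shrink : ∀ {P} → Separators P → ∀ k e → P e ≡ true → (s : Separator B e) → count (inside s) < k → DisjointSeparator P
  shrink {P} seps (suc k) e p s (s≤s le) with search (λ i → inside s i ∧ P i)
  ... | inj₂ none = e , p , s , λ i u q → false≢true (none i) (∧-intro u q)
  ... | inj₁ (f , h) = shrink seps k f q smaller
          (≤-trans (s≤s (count-mono (λ i w → ∖-intro {P = inside s} (∧-projₗ w)
             (λ { refl → false≢true (avoids (seps f q)) (∧-projᵣ {inside s i} w) }))))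
             (≤-trans (≤-reflexive (sym (count-∖ (inside s) f u))) le))
    where
    u : inside s f ≡ true
    u = ∧-projₗ h
    q : P f ≡ true
    q = ∧-projᵣ {inside s f} h
    smaller : Separator B f
    smaller .inside i = inside s i ∧ inside (seps f q) i
    smaller .closed i j w b = ∧-intro (closed s i j (∧-projₗ w) b) (closed (seps f q) i j (∧-projᵣ {inside s i} w) b)
    smaller .avoids = trans (cong (inside s f ∧_) (avoids (seps f q))) (∧-zeroʳ (inside s f))
    smaller .nbrs j b j≢f = ∧-intro (closed s f j u b) (nbrs (seps f q) j b j≢f)

  disjointSeparator : ∀ {P} → Separators P → 1 ≤ count P → DisjointSeparator P
  disjointSeparator {P} seps le with count-pos P le
  ... | e , p = shrink seps _ e p (seps e p) ≤-refl

  -- Rows of inside elements stay inside. An out-neighbour g of e lies there, the row of g brings a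
  -- second element, and one of these two rows has three entries.
  separator-size : ThreeButOneRow B → ∀ {e} (s : Separator B e) → 3 ≤ count (inside s)
  separator-size (two , three) {e} s
    with count-pos (B e ∖ e) (≤-pred (≤-trans (two e) (count-∖-≤ (B e) e)))
  ... | g , hg = again
    where
    U = inside s
    ug : U g ≡ true
    ug = nbrs s g (∧-projₗ hg) (∖-≢ {P = B e} hg)
    row : ∀ {i} → U i ≡ true → count (B i) ≤ count U
    row {i} u = count-mono (λ j b → closed s i j u b)
    again : 3 ≤ count U
    again with count-pos (U ∖ g) (≤-pred (≤-trans (≤-trans (two g) (row ug)) (count-∖-≤ U g)))
    ... | g′ , hg′ = [ (λ le → ≤-trans le (row ug)) , (λ le → ≤-trans le (row (∧-projₗ hg′))) ]′
                     (three g g′ (λ e → ∖-≢ {P = U} hg′ (sym e)))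

-- Shrunk separators on the two sides can be made disjoint from each other and from P, and the
-- degree condition gives each of them at least three elements.
no-separators : ∀ {B : Matrix n} → n ≤ 8 → ThreeButOneRow B → ThreeButOneRow (flip B) →
  ∀ {P} → 3 ≤ count P → Separators {B = B} P → ⊥
no-separators {n} {B} n≤8 rows cols {P} P≥3 seps
  with disjointSeparator seps (≤-trans (s≤s z≤n) P≥3) | disjointSeparator (λ e p → dual (seps e p)) (≤-trans (s≤s z≤n) P≥3)
... | e , p , s , s∩P | e′ , p′ , t , t∩P = arith (count U) (count W) (count P) (count (λ i → U i ∨ W i))
        (separator-size rows s) (separator-size cols t′) P≥3
        (≤-reflexive (count-disjoint U W (λ i u w → false≢true (not-elim (∧-projᵣ {inside t i} w)) u)))
        (≤-trans (≤-reflexive (count-disjoint (λ i → U i ∨ W i) P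
           (λ i uw q → [ (λ u → s∩P i u q) , (λ w → t∩P i (∧-projₗ w) q) ]′ (∨-elim {U i} uw))))
           (≤-trans (count-≤n _) n≤8))
  where
  U = inside s
  -- Removing U leaves a separator: the complement of U is closed under reversed arcs, and an
  -- in-neighbour of e′ in U would pull e′, an element of P, into U.
  t′ : Separator (flip B) e′
  t′ .inside i = inside t i ∧ not (U i)
  t′ .closed j i w b = ∧-intro (closed t j i (∧-projₗ w) b)
    (not-intro (≢true⇒false (λ u → false≢true (not-elim (∧-projᵣ {inside t j} w)) (closed s i j u b))))
  t′ .avoids = cong (_∧ not (U e′)) (avoids t)
  t′ .nbrs i b i≢e′ = ∧-intro (nbrs t i b i≢e′) (not-intro (≢true⇒false (λ u → s∩P e′ (closed s i e′ u b) p′)))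
  W = inside t′
  arith : ∀ u w p uw → 3 ≤ u → 3 ≤ w → 3 ≤ p → u + w ≤ uw → uw + p ≤ 8 → ⊥
  arith u w p uw h₁ h₂ h₃ h₄ h₅ = linear-⊥ 0 (+-mono-≤ (+-mono-≤ h₁ h₂) (+-mono-≤ h₃ (+-mono-≤ h₄ h₅)))
    (solve (u ∷ w ∷ p ∷ uw ∷ []))

-- As the diagonal is true, S and T can meet only in e, so |S| + |T| ≤ n + 1. A violator attains
-- this bound; hence apart from e the set T is the complement of S, and no arc leads from the
-- complement of T into T.
separator-from-violator : ∀ {B : Matrix n} → (∀ i → B i i ≡ true) → ∀ e → HallViolator (deleteEdge B e e) → Separator B e
separator-from-violator {n} {B} diag e (S , T , empty , big) = record
  { inside = λ i → not (T i)
  ; closed = λ i j u b → not-intro (≢true⇒false (λ t → closed′ i j (not-elim u) t b))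
  ; avoids = cong not T-e
  ; nbrs = λ j b j≢e → not-intro (≢true⇒false (λ t → j≢e (proj₂ (deleteEdge-hit B (empty e j S-e t) b))))
  }
  where
  at-most : ∀ i → ⟦ S i ⟧ + ⟦ T i ⟧ ≤ 1 + ⟦ i == e ⟧
  at-most i with bool-cases (S i) | bool-cases (T i)
  ... | inj₂ s | _ = ≤-trans (≤-reflexive (cong (λ b → ⟦ b ⟧ + ⟦ T i ⟧) s)) (≤-trans (⟦⟧≤1 (T i)) (s≤s z≤n))
  ... | inj₁ _ | inj₂ t = ≤-trans (≤-reflexive (trans (cong (λ b → ⟦ S i ⟧ + ⟦ b ⟧) t) (+-identityʳ _))) (≤-trans (⟦⟧≤1 (S i)) (s≤s z≤n))
  ... | inj₁ s | inj₁ t = ≤-trans (+-mono-≤ (⟦⟧≤1 (S i)) (⟦⟧≤1 (T i)))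
          (≤-reflexive (cong (λ b → 1 + ⟦ b ⟧) (sym (≡⇒== (proj₁ (deleteEdge-hit B (empty i i s t) (diag i)))))))
  total : sum (λ i → 1 + ⟦ i == e ⟧) ≤ sum (λ i → ⟦ S i ⟧ + ⟦ T i ⟧)
  total = ≤-trans (≤-reflexive lhs) (≤-trans big (≤-reflexive rhs))
    where
    lhs : sum (λ i → 1 + ⟦ i == e ⟧) ≡ suc n
    lhs = trans (∑-distrib-+ (λ _ → 1) (λ i → ⟦ i == e ⟧))
            (trans (cong₂ _+_ (trans (∑-const {n} 1) (*-identityʳ n)) (trans (sym (count-def (λ i → i == e))) (count-single e))) (+-comm n 1))
    rhs : count S + count T ≡ sum (λ i → ⟦ S i ⟧ + ⟦ T i ⟧)
    rhs = trans (cong₂ _+_ (count-def S) (count-def T)) (sym (∑-distrib-+ (λ i → ⟦ S i ⟧) (λ i → ⟦ T i ⟧)))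
  exact : ∀ i → 1 + ⟦ i == e ⟧ ≤ ⟦ S i ⟧ + ⟦ T i ⟧
  exact = ∑-tight at-most total
  both : ∀ a b → 2 ≤ ⟦ a ⟧ + ⟦ b ⟧ → a ≡ true × b ≡ true
  both true true _ = refl , refl
  both true false (s≤s ())
  both false true (s≤s ())
  one-of : ∀ a b → 1 ≤ ⟦ a ⟧ + ⟦ b ⟧ → b ≡ false → a ≡ true
  one-of true _ _ _ = refl
  one-of false true _ ()
  S×T : S e ≡ true × T e ≡ true
  S×T = both (S e) (T e) (≤-trans (≤-reflexive (cong (λ b → 1 + ⟦ b ⟧) (sym (≡⇒== refl)))) (exact e))
  S-e = proj₁ S×T
  T-e = proj₂ S×T
  closed′ : ∀ i j → T i ≡ false → T j ≡ true → B i j ≡ true → ⊥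
  closed′ i j ¬t t b with refl , _ ← deleteEdge-hit B (empty i j (one-of (S i) (T i) (≤-trans (s≤s z≤n) (exact i)) ¬t) t) b =
    false≢true ¬t T-e

-- A matching without the entry (e , e) is a matching that moves e. If none exists for any e in P,
-- Hall violators supply separators for all of P.
unfix-one : n ≤ 8 → (B : Matrix n) → (∀ i → B i i ≡ true) → ThreeButOneRow B → ThreeButOneRow (flip B) →
  (P : Fin n → Bool) → 3 ≤ count P →
  Σ (PerfectMatching B) λ M → Σ (Fin n) λ e → P e ≡ true × proj₁ M e ≢ e
unfix-one n≤8 B diag rows cols P P≥3 with findOrAll attempt
  where
  attempt : ∀ e → (P e ≡ true × PerfectMatching (deleteEdge B e e)) ⊎ (P e ≡ true → Separator B e)
  attempt e with bool-cases (P e) | hall (deleteEdge B e e)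
  ... | inj₂ ¬p | _ = inj₂ (λ p → ⊥-elim (false≢true ¬p p))
  ... | inj₁ p | inj₁ M = inj₁ (p , M)
  ... | inj₁ _ | inj₂ v = inj₂ (λ _ → separator-from-violator diag e v)
... | inj₁ (e , p , f , inj , sub) = (f , inj , λ i → deleteEdge-⊆ B (sub i)) , e , p , deleteEdge-≢ B (sub e)
... | inj₂ seps = ⊥-elim (no-separators n≤8 rows cols P≥3 seps)

-- Blocks obstructing Hall's condition

-- A ∩ (S × T) is a matching although |S| + |T| ≥ 9: deleting this matching destroys Hall's condition.
record TightBlock (A : Matrix n) (S T : Fin n → Bool) : Set where
  field
    rowUnique : ∀ {i j j′} → S i ≡ true → T j ≡ true → T j′ ≡ true → A i j ≡ true → A i j′ ≡ true → j ≡ j′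
    colUnique : ∀ {j i i′} → T j ≡ true → S i ≡ true → S i′ ≡ true → A i j ≡ true → A i′ j ≡ true → i ≡ i′
    size      : 9 ≤ count S + count T

open TightBlock

flipBlock : ∀ {A : Matrix n} {S T} → TightBlock A S T → TightBlock (flip A) T S
flipBlock {S = S} {T} b = record
  { rowUnique = colUnique b ; colUnique = rowUnique b ; size = ≤-trans (size b) (≤-reflexive (+-comm (count S) (count T))) }

row≤1 : ∀ {A : Matrix n} {S T} → TightBlock A S T → ∀ {i} → S i ≡ true → count (λ j → A i j ∧ T j) ≤ 1
row≤1 {A = A} b {i} s = count-≤1 (λ j j′ p q → rowUnique b s (∧-projᵣ {A i j} p) (∧-projᵣ {A i j′} q) (∧-projₗ p) (∧-projₗ q))

-- Inclusion and exclusion, used both ways when n ≤ 8: a row of degree 4 that seldom meets U keeps U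
-- small, and a set U of five columns meets every such row.
row-bound : ∀ (R U : Fin n → Bool) → count R + count U ≤ n + count (λ j → R j ∧ U j)
row-bound {n} R U = begin
  count R + count U                                               ≡⟨ cong (_+ count U) (count-split R U) ⟩
  count R∧U + count (λ j → R j ∧ not (U j)) + count U             ≤⟨ +-monoˡ-≤ (count U) (+-monoʳ-≤ (count R∧U) (count-mono (λ j → ∧-projᵣ {R j}))) ⟩
  count R∧U + count (not ∘ U) + count U                           ≡⟨ rearrange (count R∧U) (count (not ∘ U)) (count U) ⟩
  (count U + count (not ∘ U)) + count R∧U                         ≡⟨ cong (_+ count R∧U) (count-not U) ⟩
  n + count R∧U                                                   ∎
  where
  open ≤-Reasoning
  R∧U = λ j → R j ∧ U j
  rearrange : ∀ a b c → a + b + c ≡ (c + b) + a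
  rearrange a b c = solve (a ∷ b ∷ c ∷ [])

module _ {A : Matrix n} (n≤8 : n ≤ 8) (rows : RowDegrees≥ 4 A) where

  block-nonempty : ∀ {S T} → TightBlock A S T → ∃ λ i → S i ≡ true
  block-nonempty {S} {T} b = count-pos S (+-cancelʳ-≤ 8 1 (count S) (≤-trans (size b) (+-monoʳ-≤ (count S) (≤-trans (count-≤n T) n≤8))))

  -- A row of S has at least three of its four entries outside T.
  T≤5 : ∀ {S T} → TightBlock A S T → count T ≤ 5
  T≤5 {S} {T} b with block-nonempty b
  ... | i , s = +-cancelˡ-≤ 4 (count T) 5 (≤-trans (+-monoˡ-≤ (count T) (rows i)) (≤-trans (row-bound (A i) T) (+-mono-≤ n≤8 (row≤1 b s))))

-- Two tight blocks in a matrix of minimum degree 4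

module TwoBlocks {A : Matrix n} (n≤8 : n ≤ 8) (rows : RowDegrees≥ 4 A) (cols : RowDegrees≥ 4 (flip A))
  {S T S′ T′ : Fin n → Bool} (b : TightBlock A S T) (b′ : TightBlock A S′ T′) where

  ∪S ∩S ∪T ∩T : Fin n → Bool
  ∪S i = S i ∨ S′ i
  ∩S i = S i ∧ S′ i
  ∪T j = T j ∨ T′ j
  ∩T j = T j ∧ T′ j

  S≥4 : 4 ≤ count S
  S≥4 = +-cancelʳ-≤ 5 4 (count S) (≤-trans (size b) (+-monoʳ-≤ (count S) (T≤5 n≤8 rows b)))

  S′≥4 : 4 ≤ count S′
  S′≥4 = +-cancelʳ-≤ 5 4 (count S′) (≤-trans (size b′) (+-monoʳ-≤ (count S′) (T≤5 n≤8 rows b′)))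

  ∪T≤6-at : ∀ i → ∩S i ≡ true → count ∪T ≤ 6
  ∪T≤6-at i s = +-cancelˡ-≤ 4 (count ∪T) 6 (≤-trans (+-monoˡ-≤ (count ∪T) (rows i)) (≤-trans (row-bound (A i) ∪T) (+-mono-≤ n≤8 two)))
    where
    two : count (λ j → A i j ∧ ∪T j) ≤ 2
    two = ≤-trans (count-mono distrib) (≤-trans (count-∨-≤ (λ j → A i j ∧ T j) (λ j → A i j ∧ T′ j))
            (+-mono-≤ (row≤1 b (∧-projₗ s)) (row≤1 b′ (∧-projᵣ {S i} s))))
      where
      distrib : ∀ j → A i j ∧ ∪T j ≡ true → (A i j ∧ T j) ∨ (A i j ∧ T′ j) ≡ true
      distrib j h with A i j | h
      ... | true | t = t

  S-disjoint : count ∩S < 1 → 10 ≤ count T + count T′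
  S-disjoint none = ≮⇒≥ λ small → arith (count S) (count S′) (count T) (count T′) (count ∩S) (count ∪S) none (count-∧∨ S S′)
      (≤-trans (count-≤n ∪S) n≤8) (≤-pred small) (size b) (size b′)
    where
    arith : ∀ s s′ t t′ i u → i < 1 → i + u ≡ s + s′ → u ≤ 8 → t + t′ ≤ 9 → 9 ≤ s + t → 9 ≤ s′ + t′ → ⊥
    arith s s′ t t′ i u h₁ h₂ h₃ h₄ h₅ h₆ =
      linear-⊥ 0 (+-mono-≤ h₁ (+-mono-≤ (≤-reflexive (sym h₂)) (+-mono-≤ h₃ (+-mono-≤ h₄ (+-mono-≤ h₅ h₆)))))
        (solve (s ∷ s′ ∷ t ∷ t′ ∷ i ∷ u ∷ []))

  module _ (∪S≤6-at : ∀ j → ∩T j ≡ true → count ∪S ≤ 6) where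

    -- A common row gives the bound. Otherwise |T| + |T′| ≥ 10 forces a common column, whose bound
    -- |S ∪ S′| ≤ 6 contradicts |S| + |S′| ≥ 8 for disjoint sets. The bound at a column is that of
    -- the transposed blocks, hence a parameter.
    ∪T≤6 : count ∪T ≤ 6
    ∪T≤6 with 1 ≤? count ∩S
    ... | yes le = ∪T≤6-at (proj₁ (count-pos ∩S le)) (proj₂ (count-pos ∩S le))
    ... | no none = ⊥-elim (arith (count S) (count S′) (count ∩S) (count ∪S) (≰⇒> none) (count-∧∨ S S′)
            (∪S≤6-at (proj₁ column) (proj₂ column)) S≥4 S′≥4)
      where
      ∩T≥1 : ∀ t t′ i u → 10 ≤ t + t′ → i + u ≡ t + t′ → u ≤ 8 → 1 ≤ i
      ∩T≥1 t t′ zero u h₁ h₂ h₃ = ⊥-elim (linear-⊥ 1 (+-mono-≤ h₁ (+-mono-≤ (≤-reflexive (sym h₂)) h₃)) (solve (t ∷ t′ ∷ u ∷ [])))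
      ∩T≥1 t t′ (suc i) u _ _ _ = s≤s z≤n
      column : ∃ λ j → ∩T j ≡ true
      column = count-pos ∩T (∩T≥1 (count T) (count T′) (count ∩T) (count ∪T)
        (S-disjoint (≰⇒> none)) (count-∧∨ T T′) (≤-trans (count-≤n ∪T) n≤8))
      arith : ∀ s s′ i u → i < 1 → i + u ≡ s + s′ → u ≤ 6 → 4 ≤ s → 4 ≤ s′ → ⊥
      arith s s′ i u h₁ h₂ h₃ h₄ h₅ = linear-⊥ 1 (+-mono-≤ h₁ (+-mono-≤ (≤-reflexive (sym h₂)) (+-mono-≤ h₃ (+-mono-≤ h₄ h₅))))
        (solve (s ∷ s′ ∷ i ∷ u ∷ []))

  -- If |T ∪ T′| were 6, each common row would have two entries in it, at most one of them in T′, so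
  -- one in T outside T′, in a column of its own. This gives |S ∩ S′| + |T′| ≤ 6, whereas |S| ≥ 4,
  -- |S′| + |T′| ≥ 9 and |S ∪ S′| ≤ 6 give at least 7.
  ∪T≤5 : count ∪S ≤ 6 → count ∪T ≤ 6 → count ∪T ≤ 5
  ∪T≤5 ∪S≤6 ∪T≤6 = ≮⇒≥ λ large →
    arith (count S) (count S′) (count T′) (count ∩S) (count ∪S) (count ∪T) (count T∖T′)
      (count-∧∨ S S′) ∪S≤6 ∪T≤6 S≥4 (size b′) (count-relation ∩S T∖T′ A (exit large) unique) T′+T∖T′
    where
    T∖T′ : Fin n → Bool
    T∖T′ j = T j ∧ not (T′ j)

    T′+T∖T′ : count T′ + count T∖T′ ≤ count ∪T
    T′+T∖T′ = ≤-trans (≤-reflexive (count-disjoint T′ T∖T′ (λ j t′ t → false≢true (not-elim (∧-projᵣ {T j} t)) t′)))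
      (count-mono (λ j h → [ (λ t′ → ∨-introᵣ {T j} t′) , (λ t → ∨-introₗ (∧-projₗ {T j} t)) ]′ (∨-elim {T′ j} h)))

    exit : 5 < count ∪T → ∀ i → ∩S i ≡ true → ∃ λ j → T∖T′ j ≡ true × A i j ≡ true
    exit large i s with search (λ j → T∖T′ j ∧ A i j)
    ... | inj₁ (j , h) = j , ∧-projₗ h , ∧-projᵣ {T∖T′ j} h
    ... | inj₂ none = ⊥-elim (linear-⊥ 0 (≤-trans (+-mono-≤ (rows i) large)
        (≤-trans (row-bound (A i) ∪T) (+-mono-≤ n≤8 (≤-trans (count-mono only-T′) (row≤1 b′ (∧-projᵣ {S i} s)))))) refl)
      where
      only-T′ : ∀ j → A i j ∧ ∪T j ≡ true → A i j ∧ T′ j ≡ true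
      only-T′ j h with bool-cases (T′ j)
      ... | inj₁ t′ = ∧-intro (∧-projₗ h) t′
      ... | inj₂ ¬t′ = ⊥-elim (false≢true (none j) (∧-intro (∧-intro
              ([ id , (λ t′ → ⊥-elim (false≢true ¬t′ t′)) ]′ (∨-elim {T j} (∧-projᵣ {A i j} h))) (not-intro ¬t′)) (∧-projₗ h)))

    unique : ∀ j i i′ → T∖T′ j ≡ true → ∩S i ≡ true → ∩S i′ ≡ true → A i j ≡ true → A i′ j ≡ true → i ≡ i′
    unique j i i′ t s s′ = colUnique b (∧-projₗ t) (∧-projₗ s) (∧-projₗ s′)

    arith : ∀ s s′ t′ i u v d → i + u ≡ s + s′ → u ≤ 6 → v ≤ 6 → 4 ≤ s → 9 ≤ s′ + t′ → i ≤ d → t′ + d ≤ v → ⊥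
    arith s s′ t′ i u v d h₁ h₂ h₃ h₄ h₅ h₆ h₇ =
      linear-⊥ 0 (+-mono-≤ (≤-reflexive (sym h₁)) (+-mono-≤ h₂ (+-mono-≤ h₃ (+-mono-≤ h₄ (+-mono-≤ h₅ (+-mono-≤ h₆ h₇))))))
        (solve (s ∷ s′ ∷ t′ ∷ i ∷ u ∷ v ∷ d ∷ []))

  -- Each common row has an entry in T ∪ T′ because 4 + 5 > 8. For rows outside Q it lies in the
  -- symmetric difference of T and T′, in distinct columns, so |S ∩ S′| + |T ∩ T′| ≤ |Q| + |T ∪ T′|.
  -- Adding |S ∪ S′| + |T ∪ T′| leaves |Q| and three sizes of at most 5.
  common-edges : count ∪S ≤ 5 → count ∪T ≤ 5 → 5 ≤ count ∪T → ∀ (Q : Fin n → Bool) →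
    (∀ i j → ∩S i ≡ true → ∩T j ≡ true → A i j ≡ true → Q i ≡ true) →
    (count S + count T) + (count S′ + count T′) ≤ 15 + count Q
  common-edges ∪S≤5 ∪T≤5 ∪T≥5 Q common = ≮⇒≥
    (arith (count S) (count T) (count S′) (count T′) (count ∩S) (count ∪S) (count ∩T) (count ∪T) (count Q) (count outer) (count ΔT)
      (count-∧∨ S S′) (count-∧∨ T T′) ∪S≤5 ∪T≤5 split (count-relation outer ΔT A meets unique)
      (≤-reflexive (trans (count-disjoint ∩T ΔT (λ j p q → false≢true (not-elim (∧-projᵣ {∪T j} q)) p)) (count-cong join))))
    where
    outer ΔT : Fin n → Bool
    outer i = ∩S i ∧ not (Q i)
    ΔT j = ∪T j ∧ not (∩T j)

    join : ∀ j → ∩T j ∨ ΔT j ≡ ∪T j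
    join j with T j | T′ j
    ... | true | true = refl
    ... | true | false = refl
    ... | false | true = refl
    ... | false | false = refl

    split : count ∩S ≤ count Q + count outer
    split = ≤-trans (≤-reflexive (count-split ∩S Q)) (+-monoˡ-≤ (count outer) (count-mono (λ i → ∧-projᵣ {∩S i})))

    meets : ∀ i → outer i ≡ true → ∃ λ j → ΔT j ≡ true × A i j ≡ true
    meets i h with count-pos (λ j → A i j ∧ ∪T j)
                     (+-cancelˡ-≤ 8 1 _ (≤-trans (+-mono-≤ (rows i) ∪T≥5) (≤-trans (row-bound (A i) ∪T) (+-monoˡ-≤ _ n≤8))))
    ... | j , p = j , ∧-intro (∧-projᵣ {A i j} p)
                        (not-intro (≢true⇒false (λ t → false≢true (not-elim (∧-projᵣ {∩S i} h)) (common i j (∧-projₗ h) t (∧-projₗ p))))) ,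
                      ∧-projₗ p

    unique : ∀ j i i′ → ΔT j ≡ true → outer i ≡ true → outer i′ ≡ true → A i j ≡ true → A i′ j ≡ true → i ≡ i′
    unique j i i′ t o o′ = [ (λ u → colUnique b u (∧-projₗ (∧-projₗ o)) (∧-projₗ (∧-projₗ o′)))
                           , (λ u → colUnique b′ u (∧-projᵣ {S i} (∧-projₗ o)) (∧-projᵣ {S i′} (∧-projₗ o′))) ]′ (∨-elim {T j} (∧-projₗ t))

    arith : ∀ s t s′ t′ i u a v q o d → i + u ≡ s + s′ → a + v ≡ t + t′ → u ≤ 5 → v ≤ 5 → i ≤ q + o → o ≤ d → a + d ≤ v →
      15 + q < (s + t) + (s′ + t′) → ⊥
    arith s t s′ t′ i u a v q o d h₁ h₂ h₃ h₄ h₅ h₆ h₇ h =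
      linear-⊥ 0 (+-mono-≤ h (+-mono-≤ (≤-reflexive (sym h₁)) (+-mono-≤ (≤-reflexive (sym h₂)) (+-mono-≤ h₃ (+-mono-≤ (+-mono-≤ h₄ h₄) (+-mono-≤ h₅ (+-mono-≤ h₆ h₇)))))))
        (solve (s ∷ t ∷ s′ ∷ t′ ∷ i ∷ u ∷ a ∷ v ∷ q ∷ o ∷ d ∷ []))

-- Since |S| + |T| ≥ 9, one of the two unions has at least five elements, and the count runs over
-- rows or columns accordingly. The common entries are diagonal, so Q can be read as a set of rows
-- or of columns.
tight-blocks-overlap : ∀ {A : Matrix n} → n ≤ 8 → RowDegrees≥ 4 A → RowDegrees≥ 4 (flip A) →
  ∀ {S T S′ T′} → TightBlock A S T → TightBlock A S′ T′ → (Q : Fin n → Bool) →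
  (∀ i j → S i ∧ S′ i ≡ true → T j ∧ T′ j ≡ true → A i j ≡ true → i ≡ j × Q i ≡ true) →
  (count S + count T) + (count S′ + count T′) ≤ 15 + count Q
tight-blocks-overlap n≤8 rows cols {S} {T} {S′} {T′} b b′ Q common with 5 ≤? count (λ j → T j ∨ T′ j)
... | yes ∪T≥5 = R.common-edges ∪S≤5 ∪T≤5 ∪T≥5 Q (λ i j s t a → proj₂ (common i j s t a))
  where
  module R = TwoBlocks n≤8 rows cols b b′
  module C = TwoBlocks n≤8 cols rows (flipBlock b) (flipBlock b′)
  ∪T≤5 = R.∪T≤5 (C.∪T≤6 R.∪T≤6-at) (R.∪T≤6 C.∪T≤6-at)
  ∪S≤5 = C.∪T≤5 (R.∪T≤6 C.∪T≤6-at) (C.∪T≤6 R.∪T≤6-at)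
... | no ∪T≱5 = ≤-trans (≤-reflexive (cong₂ _+_ (+-comm (count S) (count T)) (+-comm (count S′) (count T′))))
    (C.common-edges ∪T≤5 ∪S≤5 ∪S≥5 Q (λ j i t s a → subst (λ z → Q z ≡ true) (proj₁ (common i j s t a)) (proj₂ (common i j s t a))))
  where
  module R = TwoBlocks n≤8 rows cols b b′
  module C = TwoBlocks n≤8 cols rows (flipBlock b) (flipBlock b′)
  ∪T≤5 = R.∪T≤5 (C.∪T≤6 R.∪T≤6-at) (R.∪T≤6 C.∪T≤6-at)
  ∪S≤5 = C.∪T≤5 (R.∪T≤6 C.∪T≤6-at) (C.∪T≤6 R.∪T≤6-at)
  ∪S≥5 : 5 ≤ count (λ i → S i ∨ S′ i)
  ∪S≥5 = ≤-trans (+-cancelʳ-≤ 4 5 (count S) (≤-trans (TightBlock.size b) (+-monoʳ-≤ (count S)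
           (≤-trans (count-mono (λ j → ∨-introₗ)) (≤-pred (≰⇒> ∪T≱5))))))
           (count-mono (λ i → ∨-introₗ))

-- Disjoint perfect matchings

-- Pulling back along an injection cannot enlarge a set; applied to P and to its complement, it
-- cannot shrink P either.
count-reindex : ∀ {f : Fin n → Fin n} → (∀ {i j} → f i ≡ f j → i ≡ j) → (P : Fin n → Bool) → count (P ∘ f) ≡ count P
count-reindex {n} {f} inj P = ≤-antisym (image≤ P) (+-cancelʳ-≤ (count (not ∘ P)) _ _ (begin
  count P + count (not ∘ P)              ≡⟨ count-not P ⟩
  n                                      ≡⟨ count-not (P ∘ f) ⟨
  count (P ∘ f) + count (not ∘ P ∘ f)    ≤⟨ +-monoʳ-≤ (count (P ∘ f)) (image≤ (not ∘ P)) ⟩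
  count (P ∘ f) + count (not ∘ P)        ∎))
  where
  open ≤-Reasoning
  image≤ : ∀ Q → count (Q ∘ f) ≤ count Q
  image≤ Q = count-relation (Q ∘ f) Q (λ i j → f i == j) (λ i q → f i , q , ≡⇒== refl)
    (λ j i i′ _ _ _ r r′ → inj (trans (==⇒≡ r) (sym (==⇒≡ r′))))

degrees≥3 : {E : Matrix n} → RowDegrees≥ 3 E → ThreeButOneRow E
degrees≥3 rows = (λ i → ≤-trans (n≤1+n 2) (rows i)) , (λ i _ _ → inj₁ (rows i))

UnfixedTwice : Matrix n → (Fin n → Bool) → Set
UnfixedTwice {n} B P = Σ (PerfectMatching B) λ M → Σ (Fin n) λ e → Σ (Fin n) λ e′ →
  e ≢ e′ × (P e ≡ true × proj₁ M e ≢ e) × (P e′ ≡ true × proj₁ M e′ ≢ e′)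

-- A first matching f moves some e in P. If it fixes the rest of P, the entry (e , e) is deleted for
-- good, f becomes the new diagonal, and another element of P is moved relative to f.
unfix-two : n ≤ 8 → (B : Matrix n) → (∀ i → B i i ≡ true) → RowDegrees≥ 3 B → RowDegrees≥ 3 (flip B) →
  (P : Fin n → Bool) → 4 ≤ count P → UnfixedTwice B P
unfix-two {n} n≤8 B diag rows cols P P≥4
  with unfix-one n≤8 B diag (degrees≥3 rows) (degrees≥3 cols) P (≤-trans (n≤1+n 3) P≥4)
... | M@(f , inj , sub) , e , p , unfixed with search (λ i → (P ∖ e) i ∧ not (f i == i))
... | inj₁ (e′ , h) = M , e , e′ , (λ q → ∖-≢ {P = P} (∧-projₗ h) (sym q)) , (p , unfixed) ,
        (∧-projₗ (∧-projₗ h) , ==-false (not-elim (∧-projᵣ {(P ∖ e) e′} h)))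
... | inj₂ fixed = second (unfix-one n≤8 C diagC rowsC colsC (P ∖ e) (≤-pred (≤-trans P≥4 (≤-reflexive (count-∖ P e p)))))
  where
  B′ C : Matrix n
  B′ = deleteEdge B e e
  -- Renaming columns puts f on the diagonal. Only row e and the column j with f j = e have lost an
  -- entry.
  C i j = B′ i (f j)

  diagC : ∀ i → C i i ≡ true
  diagC i = deleteEdge-intro B (sub i) (λ { refl → unfixed })

  row-≥2 : ∀ i → 2 ≤ count (B′ i)
  row-≥2 i = ≤-pred (≤-trans (rows i) (≤-trans (count-∖-≤ (B i) e)
    (s≤s (count-mono (λ j h → deleteEdge-intro B (∧-projₗ h) (λ _ → ∖-≢ {P = B i} h))))))

  row-≥3 : ∀ i → i ≢ e → 3 ≤ count (B′ i)
  row-≥3 i i≢e = ≤-trans (rows i) (count-mono (λ j b → deleteEdge-intro B b (λ q _ → i≢e q)))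

  col-≥2 : ∀ j → 2 ≤ count (flip B′ j)
  col-≥2 j = ≤-pred (≤-trans (cols j) (≤-trans (count-∖-≤ (flip B j) e)
    (s≤s (count-mono (λ i h → deleteEdge-intro B (∧-projₗ h) (λ q _ → ∖-≢ {P = flip B j} h q))))))

  col-≥3 : ∀ j → j ≢ e → 3 ≤ count (flip B′ j)
  col-≥3 j j≢e = ≤-trans (cols j) (count-mono (λ i b → deleteEdge-intro B b (λ _ → j≢e)))

  rowC : ∀ i → count (B′ i) ≡ count (C i)
  rowC i = sym (count-reindex inj (B′ i))

  rowsC : ThreeButOneRow C
  rowsC = (λ i → ≤-trans (row-≥2 i) (≤-reflexive (rowC i))) , three
    where
    three : ∀ i j → i ≢ j → 3 ≤ count (C i) ⊎ 3 ≤ count (C j)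
    three i j i≢j with i Fin.≟ e
    ... | no i≢e = inj₁ (≤-trans (row-≥3 i i≢e) (≤-reflexive (rowC i)))
    ... | yes refl = inj₂ (≤-trans (row-≥3 j (λ q → i≢j (sym q))) (≤-reflexive (rowC j)))

  colsC : ThreeButOneRow (flip C)
  colsC = (λ j → col-≥2 (f j)) , three
    where
    three : ∀ i j → i ≢ j → 3 ≤ count (flip C i) ⊎ 3 ≤ count (flip C j)
    three i j i≢j with f i Fin.≟ e
    ... | no fi≢e = inj₁ (col-≥3 (f i) fi≢e)
    ... | yes fi≡e = inj₂ (col-≥3 (f j) (λ fj≡e → i≢j (inj (trans fi≡e (sym fj≡e)))))

  second : (Σ (PerfectMatching C) λ M → Σ (Fin n) λ e′ → (P ∖ e) e′ ≡ true × proj₁ M e′ ≢ e′) → UnfixedTwice B P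
  second ((g , injg , subg) , e′ , p′ , unfixed′) =
    ((λ i → f (g i)) , (λ q → injg (inj q)) , (λ i → deleteEdge-⊆ B (subg i))) , e , e′ ,
    (λ q → ∖-≢ {P = P} p′ (sym q)) , (p , deleteEdge-≢ B (subg e)) ,
    (∧-projₗ p′ , λ q → unfixed′ (inj (trans q (sym f-fixes))))
    where
    f-fixes : f e′ ≡ e′
    f-fixes with bool-cases (f e′ == e′)
    ... | inj₁ q = ==⇒≡ q
    ... | inj₂ q = ⊥-elim (false≢true (fixed e′) (∧-intro p′ (not-intro q)))

avoiding : Matrix n → (Fin n → Fin n) → Matrix n
avoiding A g i j = A i j ∧ not (j == g i)

Disjoint : (Fin n → Fin n) → (Fin n → Fin n) → Set
Disjoint f g = ∀ i → f i ≢ g i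

DisjointMatchings : Matrix n → Matrix n → Set
DisjointMatchings A B = Σ (PerfectMatching A) λ M → Σ (PerfectMatching B) λ N → Disjoint (proj₁ M) (proj₁ N)

block-edge : ∀ {A : Matrix n} {g S T} → EmptyBlock (avoiding A g) S T →
  ∀ {i j} → S i ≡ true → T j ≡ true → A i j ≡ true → j ≡ g i
block-edge {A = A} {g} empty {i} {j} s t a with bool-cases (j == g i)
... | inj₁ q = ==⇒≡ q
... | inj₂ q = ⊥-elim (false≢true (empty i j s t) (∧-intro a (not-intro q)))

-- In a violating block all entries of `A` lie on the matching N, hence no two share a row or a
-- column.
avoid-or-tight : 8 ≤ n → (A B : Matrix n) → (N : PerfectMatching B) → DisjointMatchings A B ⊎
  Σ (Fin n → Bool) λ S → Σ (Fin n → Bool) λ T → EmptyBlock (avoiding A (proj₁ N)) S T × TightBlock A S T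
avoid-or-tight 8≤n A B N@(g , inj , _) with hall (avoiding A g)
... | inj₁ (f , injf , sub) = inj₁ ((f , injf , λ i → ∧-projₗ (sub i)) , N , λ i → ==-false (not-elim (∧-projᵣ {A i (f i)} (sub i))))
... | inj₂ (S , T , empty , big) = inj₂ (S , T , empty , record
  { rowUnique = λ s t t′ a a′ → trans (block-edge empty s t a) (sym (block-edge empty s t′ a′))
  ; colUnique = λ t s s′ a a′ → inj (trans (sym (block-edge empty s t a)) (block-edge empty s′ t a′))
  ; size = ≤-trans (s≤s 8≤n) big })

-- The identity is tried first. If a block obstructs it, its diagonal entries P number at least
-- four, and a matching g of `B` that moves two of them is tried next. A block obstructing g shares
-- with the first only entries of P fixed by g, too few for `tight-blocks-overlap`.
disjoint-matchings-diag : n ≤ 8 → 8 ≤ n → (A B : Matrix n) → RowDegrees≥ 4 A → RowDegrees≥ 4 (flip A) →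
  RowDegrees≥ 3 B → RowDegrees≥ 3 (flip B) → (∀ i → B i i ≡ true) → DisjointMatchings A B
disjoint-matchings-diag {n} n≤8 8≤n A B rowsA colsA rowsB colsB diag with avoid-or-tight 8≤n A B (id , id , diag)
... | inj₁ done = done
... | inj₂ (S , T , empty , b) = second (unfix-two n≤8 B diag rowsB colsB P P≥4)
  where
  P : Fin n → Bool
  P i = S i ∧ (T i ∧ A i i)

  -- As 4 + 5 > 8, a row of S has an entry in T, and the entries of `A` in this block are diagonal.
  S⊆P : 5 ≤ count T → ∀ i → S i ≡ true → P i ≡ true
  S⊆P T≥5 i s with count-pos (λ j → A i j ∧ T j)
      (+-cancelˡ-≤ 8 1 _ (≤-trans (+-mono-≤ (rowsA i) T≥5) (≤-trans (row-bound (A i) T) (+-monoˡ-≤ _ n≤8))))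
  ... | j , h with refl ← block-edge empty s (∧-projᵣ {A i j} h) (∧-projₗ h) = ∧-intro s (∧-intro (∧-projᵣ {A i i} h) (∧-projₗ h))

  T⊆P : 5 ≤ count S → ∀ j → T j ≡ true → P j ≡ true
  T⊆P S≥5 j t with count-pos (λ i → A i j ∧ S i)
      (+-cancelˡ-≤ 8 1 _ (≤-trans (+-mono-≤ (colsA j) S≥5) (≤-trans (row-bound (flip A j) S) (+-monoˡ-≤ _ n≤8))))
  ... | i , h with refl ← block-edge empty (∧-projᵣ {A i j} h) t (∧-projₗ h) = ∧-intro (∧-projᵣ {A i i} h) (∧-intro t (∧-projₗ h))

  T≤5′ : count T ≤ 5
  T≤5′ = T≤5 n≤8 rowsA b

  S≤5′ : count S ≤ 5
  S≤5′ = T≤5 n≤8 colsA (flipBlock b)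

  S≥4 : 4 ≤ count S
  S≥4 = +-cancelʳ-≤ 5 4 (count S) (≤-trans (TightBlock.size b) (+-monoʳ-≤ (count S) T≤5′))

  T≥4 : 4 ≤ count T
  T≥4 = +-cancelˡ-≤ 5 4 (count T) (≤-trans (TightBlock.size b) (+-monoˡ-≤ (count T) S≤5′))

  P≥4 : 4 ≤ count P
  P≥4 with 5 ≤? count T
  ... | yes T≥5 = ≤-trans S≥4 (count-mono (S⊆P T≥5))
  ... | no T≱5 = ≤-trans T≥4 (count-mono (T⊆P (+-cancelʳ-≤ 4 5 (count S)
          (≤-trans (TightBlock.size b) (+-monoʳ-≤ (count S) (≤-pred (≰⇒> T≱5)))))))

  second : UnfixedTwice B P → DisjointMatchings A B
  second (N@(g , _) , e , e′ , e≢e′ , (p , unfixed) , (p′ , unfixed′)) with avoid-or-tight 8≤n A B N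
  ... | inj₁ done = done
  ... | inj₂ (S′ , T′ , empty′ , b′) = ⊥-elim (arith (count S) (count T) (count S′) (count T′) (count P) (count Q)
      (tight-blocks-overlap n≤8 rowsA colsA b b′ Q common) (TightBlock.size b) (TightBlock.size b′)
      (count-mono (λ i → ∧-projₗ)) (count-mono (λ i h → ∧-projₗ (∧-projᵣ {S i} h))) Q+2≤P)
    where
    Q : Fin n → Bool
    Q i = P i ∧ (g i == i)

    common : ∀ i j → S i ∧ S′ i ≡ true → T j ∧ T′ j ≡ true → A i j ≡ true → i ≡ j × Q i ≡ true
    common i j s t a with refl ← block-edge empty (∧-projₗ s) (∧-projₗ t) a =
      refl , ∧-intro (∧-intro (∧-projₗ {S i} s) (∧-intro (∧-projₗ {T i} t) a))
               (≡⇒== (sym (block-edge empty′ (∧-projᵣ {S i} s) (∧-projᵣ {T i} t) a)))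

    Q+2≤P : 2 + count Q ≤ count P
    Q+2≤P = ≤-trans (s≤s (s≤s (count-mono (λ i q → ∖-intro {P = P ∖ e} (∖-intro {P = P} (∧-projₗ q)
                (λ { refl → unfixed (==⇒≡ (∧-projᵣ {P i} q)) })) (λ { refl → unfixed′ (==⇒≡ (∧-projᵣ {P i} q)) })))))
              (≤-reflexive (sym (trans (count-∖ P e p) (cong suc (count-∖ (P ∖ e) e′ (∖-intro {P = P} p′ (λ q → e≢e′ (sym q))))))))

    -- Doubled: 2 (s + t) ≥ 9 + 2p ≥ 13 + 2q and 2 (s′ + t′) ≥ 18 add up to 31 + 2q, more than 2 (15
    -- + q).
    arith : ∀ s t s′ t′ p q → (s + t) + (s′ + t′) ≤ 15 + q → 9 ≤ s + t → 9 ≤ s′ + t′ → p ≤ s → p ≤ t → 2 + q ≤ p → ⊥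
    arith s t s′ t′ p q h₁ h₂ h₃ h₄ h₅ h₆ =
      linear-⊥ 0 (+-mono-≤ (+-mono-≤ h₁ h₁) (+-mono-≤ h₂ (+-mono-≤ (+-mono-≤ h₃ h₃) (+-mono-≤ h₄ (+-mono-≤ h₅ (+-mono-≤ h₆ h₆))))))
        (solve (s ∷ t ∷ s′ ∷ t′ ∷ p ∷ q ∷ []))

opaque
  -- Renaming the columns along the given matching of `B` puts it on the diagonal.
  disjoint-matchings : n ≤ 8 → 8 ≤ n → (A B : Matrix n) → RowDegrees≥ 4 A → RowDegrees≥ 4 (flip A) →
    RowDegrees≥ 3 B → RowDegrees≥ 3 (flip B) → PerfectMatching B → DisjointMatchings A B
  disjoint-matchings n≤8 8≤n A B rowsA colsA rowsB colsB (h , inj , sub)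
    with disjoint-matchings-diag n≤8 8≤n (λ i j → A i (h j)) (λ i j → B i (h j))
           (λ i → ≤-trans (rowsA i) (≤-reflexive (sym (count-reindex inj (A i))))) (λ j → colsA (h j))
           (λ i → ≤-trans (rowsB i) (≤-reflexive (sym (count-reindex inj (B i))))) (λ j → colsB (h j)) sub
  ... | (f , injf , subf) , (g , injg , subg) , dis =
    ((λ i → h (f i)) , (λ q → injf (inj q)) , subf) , ((λ i → h (g i)) , (λ q → injg (inj q)) , subg) , (λ i q → dis i (inj q))

empty-block-width : n ≤ 8 → {A : Matrix n} → RowDegrees≥ 4 A → ∀ {S T} → EmptyBlock A S T → 9 ≤ count S + count T → count T ≤ 4
empty-block-width n≤8 {A} rows {S} {T} empty big = +-cancelˡ-≤ 4 (count T) 4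
  (≤-trans (+-monoˡ-≤ (count T) (rows i)) (≤-trans (row-bound (A i) T) (≤-trans (≤-reflexive (cong (_ +_) none)) (≤-trans (≤-reflexive (+-identityʳ _)) n≤8))))
  where
  member : ∃ λ i → S i ≡ true
  member = count-pos S (+-cancelʳ-≤ 8 1 (count S) (≤-trans big (+-monoʳ-≤ (count S) (≤-trans (count-≤n T) n≤8))))
  i = proj₁ member
  none : count (λ j → A i j ∧ T j) ≡ 0
  none = count-empty (λ j → ≢true⇒false (λ h → false≢true (empty i j (proj₂ member) (∧-projᵣ {A i j} h)) (∧-projₗ h)))

opaque
  -- A row of an empty block has its four entries outside T, so |T| ≤ 4; likewise |S| ≤ 4, short of
  -- the 9 that a violator needs.
  min-degree-4-matching : n ≤ 8 → 8 ≤ n → (A : Matrix n) → RowDegrees≥ 4 A → RowDegrees≥ 4 (flip A) → PerfectMatching A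
  min-degree-4-matching n≤8 8≤n A rows cols with hall A
  ... | inj₁ M = M
  ... | inj₂ (S , T , empty , big) = ⊥-elim (linear-⊥ 0 (≤-trans S+T≥9 (+-mono-≤
        (empty-block-width n≤8 cols (λ j i t s → empty i j s t) (≤-trans S+T≥9 (≤-reflexive (+-comm (count S) (count T)))))
        (empty-block-width n≤8 rows empty S+T≥9))) refl)
    where
    S+T≥9 : 9 ≤ count S + count T
    S+T≥9 = ≤-trans (s≤s 8≤n) big

-- Subgraphs of plane graphs

Orbit : (Fin m → Fin m) → Fin m → Fin m → Set
Orbit f = Star (λ x y → f x ≡ y)

iterate : (Fin m → Fin m) → ℕ → Fin m → Fin m
iterate f zero x = x
iterate f (suc k) x = f (iterate f k x)

orbit-iterate : ∀ (f : Fin m → Fin m) k x → Orbit f x (iterate f k x)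
orbit-iterate f zero x = ε
orbit-iterate f (suc k) x = orbit-iterate f k x ◅◅ (refl ◅ ε)

iterate-suc : ∀ (f : Fin m → Fin m) k x → iterate f k (f x) ≡ iterate f (suc k) x
iterate-suc f zero x = refl
iterate-suc f (suc k) x = cong f (iterate-suc f k x)

-- By the pigeonhole principle two iterates of x agree, and injectivity cancels the earlier one down
-- to x itself.
orbit-return : ∀ (f : Fin m → Fin m) → (∀ {x y} → f x ≡ f y → x ≡ y) → ∀ x → Orbit f (f x) x
orbit-return {m} f inj x with Fin.pigeonhole (n<1+n m) (λ i → iterate f (Fin.toℕ i) x)
... | i , j , i<j , eq = subst (Orbit f (f x)) (sym (cancel (Fin.toℕ i) (Fin.toℕ j) i<j eq))
        (orbit-iterate f (Fin.toℕ j ∸ suc (Fin.toℕ i)) (f x))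
  where
  cancel : ∀ a b → a < b → iterate f a x ≡ iterate f b x → x ≡ iterate f (b ∸ suc a) (f x)
  cancel zero (suc b) (s≤s z≤n) e = trans e (sym (iterate-suc f b x))
  cancel (suc a) (suc b) (s≤s lt) e = cancel a b lt (inj e)

perm-injective : ∀ (π : Permutation′ m) {x y} → π ⟨$⟩ʳ x ≡ π ⟨$⟩ʳ y → x ≡ y
perm-injective π e = trans (sym (inverseˡ π)) (trans (cong (π ⟨$⟩ˡ_) e) (inverseˡ π))

opaque
  -- Cuts a out of its cycle: the predecessor of a is sent to the successor of a, and a becomes a
  -- fixed point.
  bypass : Permutation′ m → Fin m → Permutation′ m
  bypass π a = π ∘ₚ transpose a (π ⟨$⟩ʳ a)

  bypass-hit : ∀ (π : Permutation′ m) a {x} → π ⟨$⟩ʳ x ≡ a → bypass π a ⟨$⟩ʳ x ≡ π ⟨$⟩ʳ a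
  bypass-hit π a {x} e rewrite dec-true (π ⟨$⟩ʳ x Fin.≟ a) e = refl

  bypass-miss : ∀ (π : Permutation′ m) a {x} → π ⟨$⟩ʳ x ≢ a → x ≢ a → bypass π a ⟨$⟩ʳ x ≡ π ⟨$⟩ʳ x
  bypass-miss π a {x} ne x≢a rewrite dec-false (π ⟨$⟩ʳ x Fin.≟ a) ne
    | dec-false (π ⟨$⟩ʳ x Fin.≟ π ⟨$⟩ʳ a) (λ e → x≢a (perm-injective π e)) = refl

  bypass-self : ∀ (π : Permutation′ m) a → bypass π a ⟨$⟩ʳ a ≡ a
  bypass-self π a with π ⟨$⟩ʳ a Fin.≟ a
  ... | yes e = e
  ... | no _ rewrite dec-true (π ⟨$⟩ʳ a Fin.≟ π ⟨$⟩ʳ a) refl = refl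

module _ (π : Permutation′ m) (a : Fin m) where

  bypass-≢ : ∀ {x} → x ≢ a → bypass π a ⟨$⟩ʳ x ≢ a
  bypass-≢ x≢a e = x≢a (perm-injective (bypass π a) (trans e (sym (bypass-self π a))))

  bypass-cases : ∀ x → x ≢ a → (π ⟨$⟩ʳ x ≡ a × bypass π a ⟨$⟩ʳ x ≡ π ⟨$⟩ʳ a) ⊎ (π ⟨$⟩ʳ x ≢ a × bypass π a ⟨$⟩ʳ x ≡ π ⟨$⟩ʳ x)
  bypass-cases x x≢a with π ⟨$⟩ʳ x Fin.≟ a
  ... | yes e = inj₁ (e , bypass-hit π a e)
  ... | no ne = inj₂ (ne , bypass-miss π a ne x≢a)

  bypass-closed : ∀ {P : Fin m → Bool} → (∀ x → P x ≡ true → P (π ⟨$⟩ʳ x) ≡ true) →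
    ∀ x → (P ∖ a) x ≡ true → (P ∖ a) (bypass π a ⟨$⟩ʳ x) ≡ true
  bypass-closed {P} closed x h = ∖-intro {P = P} inP (bypass-≢ x≢a)
    where
    x≢a = ∖-≢ {P = P} h
    px : P x ≡ true
    px = ∧-projₗ h
    inP : P (bypass π a ⟨$⟩ʳ x) ≡ true
    inP with bypass-cases x x≢a
    ... | inj₁ (e , e′) = trans (cong P e′) (closed a (trans (cong P (sym e)) (closed x px)))
    ... | inj₂ (_ , e′) = trans (cong P e′) (closed x px)

  bypass-invariant : ∀ {A : Set} (t : Fin m → A) → (∀ x → t (π ⟨$⟩ʳ x) ≡ t x) → ∀ x → t (bypass π a ⟨$⟩ʳ x) ≡ t x
  bypass-invariant t inv x with x Fin.≟ a
  ... | yes refl = cong t (bypass-self π a)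
  ... | no x≢a with bypass-cases x x≢a
  ... | inj₁ (e , e′) = trans (cong t e′) (trans (inv a) (trans (cong t (sym e)) (inv x)))
  ... | inj₂ (_ , e′) = trans (cong t e′) (inv x)

  -- The second half is the induction hypothesis for a walk that stands on a: the shortened walk has
  -- already arrived at the successor of a.
  bypass-orbit : ∀ {x y} → y ≢ a → Orbit (π ⟨$⟩ʳ_) x y →
    (x ≢ a → Orbit (bypass π a ⟨$⟩ʳ_) x y) × (x ≡ a → Orbit (bypass π a ⟨$⟩ʳ_) (π ⟨$⟩ʳ a) y)
  bypass-orbit y≢a ε = (λ _ → ε) , (λ e → ⊥-elim (y≢a e))
  bypass-orbit {x} {y} y≢a (refl ◅ p) = off , on
    where
    rec = bypass-orbit y≢a p
    off : x ≢ a → Orbit (bypass π a ⟨$⟩ʳ_) x y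
    off x≢a with bypass-cases x x≢a
    ... | inj₁ (e , e′) = e′ ◅ proj₂ rec e
    ... | inj₂ (ne , e′) = e′ ◅ proj₁ rec ne
    on : x ≡ a → Orbit (bypass π a ⟨$⟩ʳ_) (π ⟨$⟩ʳ a) y
    on refl with π ⟨$⟩ʳ x Fin.≟ x
    ... | yes e = proj₂ rec e
    ... | no ne = proj₁ rec ne

fixed-orbit : ∀ {f : Fin m → Fin m} {x y} → f x ≡ x → Orbit f x y → x ≡ y
fixed-orbit fix ε = refl
fixed-orbit {f = f} fix (refl ◅ p) = trans (sym fix) (fixed-orbit (cong f fix) p)

¬¬-finite : {P : Fin k → Set} → (∀ i → ¬ ¬ P i) → ¬ ¬ (∀ i → P i)
¬¬-finite {zero} h ¬p = ¬p (λ ())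
¬¬-finite {suc k} h ¬p = h zero (λ p → ¬¬-finite (h ∘ suc) (λ ps → ¬p (λ { zero → p ; (suc i) → ps i })))

merge-labels : ∀ (a b : Fin k) → a ≢ b → Σ ℕ λ k′ → Σ (Fin k → Fin k′) λ μ →
  μ a ≡ μ b × (∀ g → Σ (Fin k) λ f → μ f ≡ g) × k ≤ suc k′
merge-labels {suc k} a b a≢b = k , μ , trans (μ-≢ a a≢b) (sym μ-b) , (λ g → Fin.punchIn b g , surj g) , ≤-refl
  where
  μ : Fin (suc k) → Fin k
  μ f with b Fin.≟ f
  ... | yes _ = Fin.punchOut {i = b} {j = a} (λ e → a≢b (sym e))
  ... | no b≢f = Fin.punchOut {i = b} {j = f} b≢f
  μ-b : μ b ≡ Fin.punchOut {i = b} {j = a} (λ e → a≢b (sym e))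
  μ-b with b Fin.≟ b
  ... | yes _ = refl
  ... | no ne = ⊥-elim (ne refl)
  μ-≢ : ∀ f (ne : f ≢ b) → μ f ≡ Fin.punchOut {i = b} {j = f} (λ e → ne (sym e))
  μ-≢ f ne with b Fin.≟ f
  ... | yes e = ⊥-elim (ne (sym e))
  ... | no b≢f = Fin.punchOut-cong b refl
  surj : ∀ g → μ (Fin.punchIn b g) ≡ g
  surj g = trans (μ-≢ (Fin.punchIn b g) (Fin.punchInᵢ≢i b g)) (Fin.punchOut-punchIn b)

-- Edge deletion in plane embeddings

record DartGraph : Set where
  field
    vertices darts : ℕ
    tail      : Fin darts → Fin vertices
    rev       : Fin darts → Fin darts
    rev-invol : ∀ d → rev (rev d) ≡ d
    loopless  : ∀ d → tail (rev d) ≢ tail d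
    simple    : ∀ d d′ → tail d ≡ tail d′ → tail (rev d) ≡ tail (rev d′) → d ≡ d′

module _ (D : DartGraph) where
  open DartGraph D

  Step : (Fin darts → Bool) → Fin vertices → Fin vertices → Set
  Step live u v = Σ (Fin darts) λ d → live d ≡ true × tail d ≡ u × tail (rev d) ≡ v

  Reach : (Fin darts → Bool) → Fin vertices → Fin vertices → Set
  Reach live = Star (Step live)

  Isolated : (Fin darts → Bool) → Fin vertices → Set
  Isolated live v = ∀ d → live d ≡ true → tail d ≢ v

  -- Face labels need only be constant on face orbits, and a vertex that has lost its last dart owns
  -- a face (bare); i₀ counts the vertices isolated from the start, which own none.  With these
  -- conventions Euler's formula becomes an inequality that every edge deletion preserves.
  record SubEmbedding (live : Fin darts → Bool) (i₀ : ℕ) : Set where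
    field
      live-rev  : ∀ d → live d ≡ true → live (rev d) ≡ true
      ρ         : Permutation′ darts
      ρ-tail    : ∀ d → tail (ρ ⟨$⟩ʳ d) ≡ tail d
      ρ-live    : ∀ d → live d ≡ true → live (ρ ⟨$⟩ʳ d) ≡ true
      ρ-cycle   : ∀ d d′ → live d ≡ true → live d′ ≡ true → tail d ≡ tail d′ → Orbit (ρ ⟨$⟩ʳ_) d d′
      F         : ℕ
      face      : Fin darts → Fin F
      face-next : ∀ d → live d ≡ true → face (ρ ⟨$⟩ʳ (rev d)) ≡ face d
      bare      : Fin vertices → Maybe (Fin F)
      witness   : ∀ f → (Σ (Fin darts) λ d → live d ≡ true × face d ≡ f) ⊎
                        (Σ (Fin darts) λ d → Isolated live (tail d) × bare (tail d) ≡ just f)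
      c         : ℕ
      comp      : Fin vertices → Fin c
      comp-conn : ∀ u v → comp u ≡ comp v → Reach live u v
      euler     : 4 * c + count live ≤ 2 * (vertices + F + i₀)

  module Delete {live : Fin darts → Bool} {i₀ : ℕ} (E : SubEmbedding live i₀) (d₀ : Fin darts) (live-d₀ : live d₀ ≡ true) where
    open SubEmbedding E

    d₁ : Fin darts
    d₁ = rev d₀

    u v : Fin vertices
    u = tail d₀
    v = tail d₁

    live′ : Fin darts → Bool
    live′ = live ∖ d₀ ∖ d₁

    live-d₁ : live d₁ ≡ true
    live-d₁ = live-rev d₀ live-d₀

    d₁≢d₀ : d₁ ≢ d₀
    d₁≢d₀ e = loopless d₀ (cong tail e)

    live′-intro : ∀ {x} → live x ≡ true → x ≢ d₀ → x ≢ d₁ → live′ x ≡ true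
    live′-intro l ne₀ ne₁ = ∖-intro {P = live ∖ d₀} (∖-intro {P = live} l ne₀) ne₁

    live′-⊆ : ∀ {x} → live′ x ≡ true → live x ≡ true
    live′-⊆ l = ∧-projₗ (∧-projₗ l)

    live′-≢₀ : ∀ {x} → live′ x ≡ true → x ≢ d₀
    live′-≢₀ l = ∖-≢ {P = live} (∧-projₗ l)

    live′-≢₁ : ∀ {x} → live′ x ≡ true → x ≢ d₁
    live′-≢₁ l = ∖-≢ {P = live ∖ d₀} l

    rev-≢₀ : ∀ {x} → x ≢ d₁ → rev x ≢ d₀
    rev-≢₀ ne e = ne (trans (sym (rev-invol _)) (cong rev e))

    rev-≢₁ : ∀ {x} → x ≢ d₀ → rev x ≢ d₁
    rev-≢₁ ne e = ne (trans (sym (rev-invol _)) (trans (cong rev e) (rev-invol d₀)))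

    live′-rev : ∀ d → live′ d ≡ true → live′ (rev d) ≡ true
    live′-rev d l = live′-intro (live-rev d (live′-⊆ l)) (rev-≢₀ (live′-≢₁ l)) (rev-≢₁ (live′-≢₀ l))

    count-live : 2 + count live′ ≡ count live
    count-live = sym (trans (count-∖ live d₀ live-d₀) (cong suc (count-∖ (live ∖ d₀) d₁ (∖-intro {P = live} live-d₁ d₁≢d₀))))

    ρ₁ ρ′ : Permutation′ darts
    ρ₁ = bypass ρ d₀
    ρ′ = bypass ρ₁ d₁

    ρ′-tail : ∀ d → tail (ρ′ ⟨$⟩ʳ d) ≡ tail d
    ρ′-tail = bypass-invariant ρ₁ d₁ tail (bypass-invariant ρ d₀ tail ρ-tail)

    ρ′-live : ∀ d → live′ d ≡ true → live′ (ρ′ ⟨$⟩ʳ d) ≡ true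
    ρ′-live = bypass-closed ρ₁ d₁ {P = live ∖ d₀} (bypass-closed ρ d₀ {P = live} ρ-live)

    ρ′-cycle : ∀ d d′ → live′ d ≡ true → live′ d′ ≡ true → tail d ≡ tail d′ → Orbit (ρ′ ⟨$⟩ʳ_) d d′
    ρ′-cycle d d′ l l′ e = proj₁ (bypass-orbit ρ₁ d₁ (live′-≢₁ l′)
      (proj₁ (bypass-orbit ρ d₀ (live′-≢₀ l′) (ρ-cycle d d′ (live′-⊆ l) (live′-⊆ l′) e)) (live′-≢₀ l))) (live′-≢₁ l)

    ρd₀≢d₁ : ρ ⟨$⟩ʳ d₀ ≢ d₁
    ρd₀≢d₁ e = loopless d₀ (trans (cong tail (sym e)) (ρ-tail d₀))

    ρd₁≢d₀ : ρ ⟨$⟩ʳ d₁ ≢ d₀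
    ρd₁≢d₀ e = loopless d₀ (trans (sym (ρ-tail d₁)) (cong tail e))

    ρ′-cases : ∀ y → y ≢ d₀ → y ≢ d₁ → (ρ′ ⟨$⟩ʳ y ≡ ρ ⟨$⟩ʳ y) ⊎
      (ρ ⟨$⟩ʳ y ≡ d₀ × ρ′ ⟨$⟩ʳ y ≡ ρ ⟨$⟩ʳ d₀) ⊎ (ρ ⟨$⟩ʳ y ≡ d₁ × ρ′ ⟨$⟩ʳ y ≡ ρ ⟨$⟩ʳ d₁)
    ρ′-cases y ne₀ ne₁ with bypass-cases ρ d₀ y ne₀ | bypass-cases ρ₁ d₁ y ne₁
    ... | inj₁ (e , e₁) | inj₁ (e′ , _) = ⊥-elim (ρd₀≢d₁ (trans (sym e₁) e′))
    ... | inj₁ (e , e₁) | inj₂ (_ , e′) = inj₂ (inj₁ (e , trans e′ e₁))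
    ... | inj₂ (_ , e₁) | inj₁ (e , e′) = inj₂ (inj₂ (trans (sym e₁) e , trans e′ (bypass-miss ρ d₀ ρd₁≢d₀ d₁≢d₀)))
    ... | inj₂ (_ , e₁) | inj₂ (_ , e′) = inj₁ (trans e′ e₁)

    face-ρd₀ : face (ρ ⟨$⟩ʳ d₀) ≡ face d₁
    face-ρd₀ = trans (cong (λ x → face (ρ ⟨$⟩ʳ x)) (sym (rev-invol d₀))) (face-next d₁ live-d₁)

    face-ρd₁ : face (ρ ⟨$⟩ʳ d₁) ≡ face d₀
    face-ρd₁ = face-next d₀ live-d₀

    -- Where a face walk was about to enter d₀ or d₁, it now skips the deleted edge and continues on
    -- its other side.
    face-next′ : ∀ d → live′ d ≡ true → (face (ρ′ ⟨$⟩ʳ (rev d)) ≡ face d) ⊎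
      (face d ≡ face d₀ × face (ρ′ ⟨$⟩ʳ (rev d)) ≡ face d₁) ⊎ (face d ≡ face d₁ × face (ρ′ ⟨$⟩ʳ (rev d)) ≡ face d₀)
    face-next′ d l with ρ′-cases (rev d) (rev-≢₀ (live′-≢₁ l)) (rev-≢₁ (live′-≢₀ l))
    ... | inj₁ e = inj₁ (trans (cong face e) (face-next d (live′-⊆ l)))
    ... | inj₂ (inj₁ (e , e′)) = inj₂ (inj₁ (trans (sym (face-next d (live′-⊆ l))) (cong face e) , trans (cong face e′) face-ρd₀))
    ... | inj₂ (inj₂ (e , e′)) = inj₂ (inj₂ (trans (sym (face-next d (live′-⊆ l))) (cong face e) , trans (cong face e′) face-ρd₁))

    -- Keeps the label of d₁ witnessed after d₁ is gone: its successor survives unless d₀ was the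
    -- last dart at u, and then u becomes a bare vertex.
    corner-u : live′ (ρ ⟨$⟩ʳ d₀) ≡ true ⊎ Isolated live′ u
    corner-u with ρ ⟨$⟩ʳ d₀ Fin.≟ d₀
    ... | no ne = inj₁ (live′-intro (ρ-live d₀ live-d₀) ne ρd₀≢d₁)
    ... | yes fix = inj₂ (λ d l e → live′-≢₀ l (sym (fixed-orbit fix (ρ-cycle d₀ d live-d₀ (live′-⊆ l) (sym e)))))

    corner-v : live′ (ρ ⟨$⟩ʳ d₁) ≡ true ⊎ Isolated live′ v
    corner-v with ρ ⟨$⟩ʳ d₁ Fin.≟ d₁
    ... | no ne = inj₁ (live′-intro (ρ-live d₁ live-d₁) ρd₁≢d₀ ne)
    ... | yes fix = inj₂ (λ d l e → live′-≢₁ l (sym (fixed-orbit fix (ρ-cycle d₁ d live-d₁ (live′-⊆ l) (sym e)))))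

    isolated-≢u : ∀ {w} → Isolated live w → w ≢ u
    isolated-≢u iso e = iso d₀ live-d₀ (sym e)

    isolated-≢v : ∀ {w} → Isolated live w → w ≢ v
    isolated-≢v iso e = iso d₁ live-d₁ (sym e)

    isolated′ : ∀ {w} → Isolated live w → Isolated live′ w
    isolated′ iso d l = iso d (live′-⊆ l)

    reach′-sym : ∀ {a b} → Reach live′ a b → Reach live′ b a
    reach′-sym = Star.reverse (λ { (d , l , e , e′) → rev d , live′-rev d l , e′ , trans (cong tail (rev-invol d)) e })

    reach-keep : Reach live′ u v → ∀ {a b} → Reach live a b → Reach live′ a b
    reach-keep u~v ε = ε
    reach-keep u~v ((d , l , refl , refl) ◅ p) with d Fin.≟ d₀ | d Fin.≟ d₁
    ... | yes refl | _ = u~v ◅◅ reach-keep u~v p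
    ... | no _ | yes refl = subst (Reach live′ v) (sym (cong tail (rev-invol d₀))) (reach′-sym u~v) ◅◅ reach-keep u~v p
    ... | no ne₀ | no ne₁ = (d , live′-intro l ne₀ ne₁ , refl , refl) ◅ reach-keep u~v p

    -- For a walk that uses the deleted edge, only the parts before its first and after its last
    -- passage are kept.
    reach-cut : ∀ {a b} → Reach live a b → Reach live′ a b ⊎
      ((Reach live′ a u ⊎ Reach live′ a v) × (Reach live′ u b ⊎ Reach live′ v b))
    reach-cut ε = inj₁ ε
    reach-cut ((d , l , refl , refl) ◅ p) with d Fin.≟ d₀ | d Fin.≟ d₁
    ... | yes refl | _ = inj₂ (inj₁ ε , [ inj₂ , proj₂ ]′ (reach-cut p))
    ... | no _ | yes refl = inj₂ (inj₂ ε , [ (λ q → inj₁ (subst (λ w → Reach live′ w _) (cong tail (rev-invol d₀)) q)) , proj₂ ]′ (reach-cut p))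
    ... | no ne₀ | no ne₁ = [ (λ q → inj₁ (step ◅ q)) , (λ { (q , r) → inj₂ ([ (λ q → inj₁ (step ◅ q)) , (λ q → inj₂ (step ◅ q)) ]′ q , r) }) ]′ (reach-cut p)
      where
      step = d , live′-intro l ne₀ ne₁ , refl , refl

    -- If the two sides of the edge lie in different faces, the walk around the face of d₀ is a
    -- detour joining the ends of the edge.
    detour : face d₀ ≢ face d₁ → Reach live′ u v
    detour ne = reach′-sym (walk (ρ ⟨$⟩ʳ (rev d₀)) (ρ-live _ live-d₁) (face-next d₀ live-d₀)
      (subst (Reach live′ v) (sym (ρ-tail d₁)) ε) (orbit-return next next-injective d₀))
      where
      next : Fin darts → Fin darts
      next x = ρ ⟨$⟩ʳ (rev x)
      next-injective : ∀ {x y} → next x ≡ next y → x ≡ y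
      next-injective {x} {y} e = trans (sym (rev-invol x)) (trans (cong rev (perm-injective ρ e)) (rev-invol y))
      walk : ∀ y → live y ≡ true → face y ≡ face d₀ → Reach live′ v (tail y) → Orbit next y d₀ → Reach live′ v u
      walk y l f r ε = r
      walk y l f r (refl ◅ p) with y Fin.≟ d₀
      ... | yes refl = r
      ... | no ne₀ = walk (next y) (ρ-live _ (live-rev y l)) (trans (face-next y l) f)
            (r ◅◅ ((y , live′-intro l ne₀ (λ { refl → ne (sym f) }) , refl , sym (ρ-tail (rev y))) ◅ ε)) p

    -- For edges whose ends stay connected. At most one face is lost, which lowers the right side of
    -- Euler's inequality by at most 2, and two darts are lost on the left.
    merge-faces : ∀ {F′} (μ : Fin F → Fin F′) → μ (face d₀) ≡ μ (face d₁) → (∀ g → Σ (Fin F) λ f → μ f ≡ g) → F ≤ suc F′ →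
      Reach live′ u v → SubEmbedding live′ i₀
    merge-faces {F′} μ μ-eq μ-surj F≤ u~v = record
      { live-rev = live′-rev
      ; ρ = ρ′
      ; ρ-tail = ρ′-tail
      ; ρ-live = ρ′-live
      ; ρ-cycle = ρ′-cycle
      ; F = F′
      ; face = λ d → μ (face d)
      ; face-next = λ d l → [ cong μ , [ (λ { (e , e′) → trans (cong μ e′) (trans (sym μ-eq) (cong μ (sym e))) })
                                       , (λ { (e , e′) → trans (cong μ e′) (trans μ-eq (cong μ (sym e))) }) ]′ ]′ (face-next′ d l)
      ; bare = bare′
      ; witness = witness′
      ; c = c
      ; comp = comp
      ; comp-conn = λ a b e → reach-keep u~v (comp-conn a b e)
      ; euler = arith c (count live′) vertices F F′ i₀ (≤-trans (≤-reflexive (cong (4 * c +_) count-live)) euler) F≤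
      }
      where
      bare′ : Fin vertices → Maybe (Fin F′)
      bare′ w = if w == u then just (μ (face d₁)) else Maybe.map μ (bare w)

      at-u : ∀ g → μ (face d₁) ≡ g → (Σ (Fin darts) λ d → live′ d ≡ true × μ (face d) ≡ g) ⊎
                        (Σ (Fin darts) λ d → Isolated live′ (tail d) × bare′ (tail d) ≡ just g)
      at-u g e with corner-u
      ... | inj₁ l = inj₁ (ρ ⟨$⟩ʳ d₀ , l , trans (cong μ face-ρd₀) e)
      ... | inj₂ iso = inj₂ (d₀ , iso , trans (cong (λ b → if b then just (μ (face d₁)) else Maybe.map μ (bare u)) (≡⇒== refl)) (cong just e))

      witness′ : ∀ g → (Σ (Fin darts) λ d → live′ d ≡ true × μ (face d) ≡ g) ⊎
                        (Σ (Fin darts) λ d → Isolated live′ (tail d) × bare′ (tail d) ≡ just g)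
      witness′ g with μ-surj g
      ... | f , refl with witness f
      ... | inj₂ (d , iso , e) = inj₂ (d , isolated′ iso , trans
              (cong (λ b → if b then just (μ (face d₁)) else Maybe.map μ (bare (tail d))) (≢⇒== (isolated-≢u iso))) (cong (Maybe.map μ) e))
      ... | inj₁ (d , l , refl) with d Fin.≟ d₀ | d Fin.≟ d₁
      ... | yes refl | _ = at-u (μ (face d)) (sym μ-eq)
      ... | no _ | yes refl = at-u (μ (face d)) refl
      ... | no ne₀ | no ne₁ = inj₁ (d , live′-intro l ne₀ ne₁ , refl)

      arith : ∀ c l n F F′ i → 4 * c + (2 + l) ≤ 2 * (n + F + i) → F ≤ suc F′ → 4 * c + l ≤ 2 * (n + F′ + i)
      arith c l n F F′ i h₁ h₂ = ≮⇒≥ (contradictory c l n F F′ i h₁ h₂)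
        where
        contradictory : ∀ c l n F F′ i → 4 * c + (2 + l) ≤ 2 * (n + F + i) → F ≤ suc F′ → 2 * (n + F′ + i) < 4 * c + l → ⊥
        contradictory c l n F F′ i h₁ h₂ h₃ = linear-⊥ 0 (+-mono-≤ h₁ (+-mono-≤ (+-mono-≤ h₂ h₂) h₃))
          (solve (c ∷ l ∷ n ∷ F ∷ F′ ∷ i ∷ []))

    -- For bridges. The part of the face on the side of u gets the new label `zero`, and that side
    -- becomes a new component. The left side changes by 4 - 2, the right side by 2.
    split-face : face d₀ ≡ face d₁ → ¬ Reach live′ u v → (∀ w → Dec (Reach live′ u w)) → SubEmbedding live′ i₀
    split-face same bridge side? = record
      { live-rev = live′-rev
      ; ρ = ρ′
      ; ρ-tail = ρ′-tail
      ; ρ-live = ρ′-live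
      ; ρ-cycle = ρ′-cycle
      ; F = suc F
      ; face = face′
      ; face-next = λ d l → cong₂ (λ f b → if (f == face d₀) ∧ b then zero else suc f) (face-next″ d l) (side-next d l)
      ; bare = bare′
      ; witness = witness′
      ; c = suc c
      ; comp = λ w → if side w then zero else suc (comp w)
      ; comp-conn = comp-conn′
      ; euler = arith c (count live′) vertices F i₀ (≤-trans (≤-reflexive (cong (4 * c +_) count-live)) euler)
      }
      where
      side : Fin vertices → Bool
      side w = does (side? w)

      face-next″ : ∀ d → live′ d ≡ true → face (ρ′ ⟨$⟩ʳ (rev d)) ≡ face d
      face-next″ d l = [ id , [ (λ { (e , e′) → trans e′ (trans (sym same) (sym e)) }) , (λ { (e , e′) → trans e′ (trans same (sym e)) }) ]′ ]′ (face-next′ d l)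

      side-true : ∀ {w} → Reach live′ u w → side w ≡ true
      side-true {w} = dec-true (side? w)

      side-reach : ∀ {w} → side w ≡ true → Reach live′ u w
      side-reach {w} = does-true (side? w)

      side-next : ∀ d → live′ d ≡ true → side (tail (ρ′ ⟨$⟩ʳ (rev d))) ≡ side (tail d)
      side-next d l with bool-cases (side (tail d))
      ... | inj₁ s = trans (side-true (side-reach s ◅◅ ((d , l , refl , sym (ρ′-tail (rev d))) ◅ ε))) (sym s)
      ... | inj₂ s = trans (≢true⇒false (λ s′ → false≢true s (side-true (side-reach s′ ◅◅
                ((rev d , live′-rev d l , sym (ρ′-tail (rev d)) , cong tail (rev-invol d)) ◅ ε))))) (sym s)

      face′ : Fin darts → Fin (suc F)
      face′ d = if (face d == face d₀) ∧ side (tail d) then zero else suc (face d)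

      bare′ : Fin vertices → Maybe (Fin (suc F))
      -- If u is left isolated it owns the new label, and v likewise the old one; at vertices that
      -- still have live darts these values are never consulted.
      bare′ w = if w == u then just zero else (if w == v then just (suc (face d₀)) else Maybe.map suc (bare w))

      Witness : Fin (suc F) → Set
      Witness g = (Σ (Fin darts) λ d → live′ d ≡ true × face′ d ≡ g) ⊎
                  (Σ (Fin darts) λ d → Isolated live′ (tail d) × bare′ (tail d) ≡ just g)

      face′-zero : ∀ {d} → face d ≡ face d₀ → side (tail d) ≡ true → face′ d ≡ zero
      face′-zero {d} e s = cong (λ b → if b then zero else suc (face d)) (∧-intro (≡⇒== e) s)

      face′-suc : ∀ {d} → (face d ≡ face d₀ → side (tail d) ≡ true → ⊥) → face′ d ≡ suc (face d)
      face′-suc {d} h = cong (λ b → if b then zero else suc (face d)) (≢true⇒false (λ t → h (==⇒≡ (∧-projₗ t)) (∧-projᵣ {face d == face d₀} t)))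

      bare′-≢u : ∀ {w} → w ≢ u → bare′ w ≡ (if w == v then just (suc (face d₀)) else Maybe.map suc (bare w))
      bare′-≢u {w} ne = cong (λ b → if b then just zero else (if w == v then just (suc (face d₀)) else Maybe.map suc (bare w))) (≢⇒== ne)

      side-u : side u ≡ true
      side-u = side-true ε

      side-v : side v ≡ true → ⊥
      side-v s = bridge (side-reach s)

      witness-u : Witness zero
      witness-u with corner-u
      ... | inj₁ l = inj₁ (ρ ⟨$⟩ʳ d₀ , l , face′-zero (trans face-ρd₀ (sym same)) (trans (cong side (ρ-tail d₀)) side-u))
      ... | inj₂ iso = inj₂ (d₀ , iso , cong (λ b → if b then just zero else (if u == v then just (suc (face d₀)) else Maybe.map suc (bare u))) (≡⇒== refl))

      witness-v : ∀ {f} → face d₀ ≡ f → Witness (suc f)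
      witness-v refl with corner-v
      ... | inj₁ l = inj₁ (ρ ⟨$⟩ʳ d₁ , l , trans (face′-suc (λ _ s → side-v (trans (cong side (sym (ρ-tail d₁))) s))) (cong suc face-ρd₁))
      ... | inj₂ iso = inj₂ (d₁ , iso , trans (bare′-≢u (loopless d₀))
                          (cong (λ b → if b then just (suc (face d₀)) else Maybe.map suc (bare v)) (≡⇒== refl)))

      witness′ : ∀ g → Witness g
      witness′ zero = witness-u
      witness′ (suc f) with face d₀ Fin.≟ f
      ... | yes e = witness-v e
      ... | no ne with witness f
      ... | inj₁ (d , l , refl) = inj₁ (d , live′-intro l (λ { refl → ne refl }) (λ { refl → ne same }) , face′-suc (λ e _ → ne (sym e)))
      ... | inj₂ (d , iso , e) = inj₂ (d , isolated′ iso , trans (bare′-≢u (isolated-≢u iso))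
              (trans (cong (λ b → if b then just (suc (face d₀)) else Maybe.map suc (bare (tail d))) (≢⇒== (isolated-≢v iso))) (cong (Maybe.map suc) e)))

      comp-conn′ : ∀ a b → (if side a then zero else suc (comp a)) ≡ (if side b then zero else suc (comp b)) → Reach live′ a b
      comp-conn′ a b e with side? a | side? b
      ... | yes r | yes r′ = reach′-sym r ◅◅ r′
      ... | no ¬r | no ¬r′ with reach-cut (comp-conn a b (Fin.suc-injective e))
      ... | inj₁ r = r
      ... | inj₂ (inj₁ a~u , _) = ⊥-elim (¬r (reach′-sym a~u))
      ... | inj₂ (inj₂ _ , inj₁ u~b) = ⊥-elim (¬r′ u~b)
      ... | inj₂ (inj₂ a~v , inj₂ v~b) = a~v ◅◅ v~b

      arith : ∀ c l n F i → 4 * c + (2 + l) ≤ 2 * (n + F + i) → 4 * suc c + l ≤ 2 * (n + suc F + i)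
      arith c l n F i h = ≤-trans (≤-reflexive left) (≤-trans (+-monoʳ-≤ 2 h) (≤-reflexive right))
        where
        left : 4 * suc c + l ≡ 2 + (4 * c + (2 + l))
        left = solve (c ∷ l ∷ [])
        right : 2 + 2 * (n + F + i) ≡ 2 * (n + suc F + i)
        right = solve (n ∷ F ∷ i ∷ [])

    -- Doubly negated because the bridge test needs reachability to be decided.
    delete : ¬ ¬ SubEmbedding live′ i₀
    delete ¬E with face d₀ Fin.≟ face d₁
    ... | no ne with merge-labels (face d₀) (face d₁) ne
    ...   | F′ , μ , μ-eq , μ-surj , F≤ = ¬E (merge-faces μ μ-eq μ-surj F≤ (detour ne))
    delete ¬E | yes same = ¬¬-finite (λ w → ¬¬-excluded-middle) decided
      where
      decided : ¬ (∀ w → Dec (Reach live′ u w))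
      decided side? with side? v
      -- The edge is no bridge although its sides carry one label: nothing has to be merged, and the
      -- inequality only gains slack.
      ... | yes u~v = ¬E (merge-faces id (cong id same) (λ g → g , refl) (n≤1+n F) u~v)
      ... | no bridge = ¬E (split-face same bridge side?)

  -- Deletes surplus edges one at a time. Because the target is closed under reversal, a dart
  -- outside it takes its reverse along without loss.
  restrict : ∀ (target : Fin darts → Bool) → (∀ d → target d ≡ true → target (rev d) ≡ true) →
    ∀ {i₀} k live → SubEmbedding live i₀ → count live < k → (∀ d → target d ≡ true → live d ≡ true) →
    ¬ ¬ (Σ (Fin darts → Bool) λ live → (∀ d → live d ≡ target d) × SubEmbedding live i₀)
  restrict target target-rev {i₀} (suc k) live E (s≤s le) sub ¬E with search (λ d → live d ∧ not (target d))
  ... | inj₂ none = ¬E (live , agree , E)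
    where
    agree : ∀ d → live d ≡ target d
    agree d with bool-cases (live d) | bool-cases (target d)
    ... | inj₁ l | inj₁ t = trans l (sym t)
    ... | inj₂ l | inj₂ t = trans l (sym t)
    ... | inj₁ l | inj₂ t = ⊥-elim (false≢true (none d) (∧-intro l (not-intro t)))
    ... | inj₂ l | inj₁ t = ⊥-elim (false≢true l (sub d t))
  ... | inj₁ (d₀ , h) = Del.delete (λ E′ → restrict target target-rev k Del.live′ E′ smaller sub′ ¬E)
    where
    module Del = Delete E d₀ (∧-projₗ h)
    t₀ : target d₀ ≡ false
    t₀ = not-elim (∧-projᵣ {live d₀} h)
    smaller : count Del.live′ < k
    smaller = ≤-trans (≤-trans (n≤1+n _) (≤-reflexive Del.count-live)) le
    sub′ : ∀ d → target d ≡ true → Del.live′ d ≡ true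
    sub′ d t = Del.live′-intro (sub d t) (λ { refl → false≢true t₀ t })
      (λ { refl → false≢true t₀ (trans (cong target (sym (rev-invol d₀))) (target-rev _ t)) })

-- Discharging

-- The statement displays both sides as products, a form the ring solver can read.
scale : ∀ k {a b} → a ≤ b → k * a ≤ k * b
scale k = *-monoʳ-≤ k

⟦∧⟧ : ∀ a b → ⟦ a ⟧ * ⟦ b ⟧ ≡ ⟦ a ∧ b ⟧
⟦∧⟧ true b = +-identityʳ ⟦ b ⟧
⟦∧⟧ false b = refl

fibre : (Fin m → Fin n) → (Fin m → ℕ) → Fin n → ℕ
fibre t w v = sum (λ d → w d * ⟦ t d == v ⟧)

∑-fibre : ∀ (t : Fin m → Fin n) w → sum w ≡ sum (fibre t w)
∑-fibre t w = sym (trans (∑-comm (λ v d → w d * ⟦ t d == v ⟧)) (sum-cong-≗ (λ d →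
  trans (∑-*ˡ (w d) (λ v → ⟦ t d == v ⟧)) (trans (cong (w d *_) (trans (sym (count-def (λ v → t d == v))) (one d))) (*-identityʳ (w d))))))
  where
  one : ∀ d → count (λ v → t d == v) ≡ 1
  one d = ≤-antisym (count-≤1 (λ i j p q → trans (sym (==⇒≡ p)) (==⇒≡ q))) (count-member (t d) (≡⇒== refl))

fibre-count : ∀ (t : Fin m → Fin n) (P : Fin m → Bool) v → fibre t (λ d → ⟦ P d ⟧) v ≡ count (λ d → P d ∧ (t d == v))
fibre-count t P v = trans (sum-cong-≗ (λ d → ⟦∧⟧ (P d) (t d == v))) (sym (count-def (λ d → P d ∧ (t d == v))))

fibre-bound : ∀ (t : Fin m → Fin n) (P : Fin m → Bool) (w : Fin m → ℕ) v c →
  (∀ d → P d ≡ true → t d ≡ v → w d ≤ c) → fibre t (λ d → ⟦ P d ⟧ * w d) v ≤ c * count (λ d → P d ∧ (t d == v))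
fibre-bound t P w v c h = ≤-trans (∑-mono pointwise)
  (≤-reflexive (trans (∑-*ˡ c (λ d → ⟦ P d ∧ (t d == v) ⟧)) (cong (c *_) (sym (count-def (λ d → P d ∧ (t d == v)))))))
  where
  pointwise : ∀ d → ⟦ P d ⟧ * w d * ⟦ t d == v ⟧ ≤ c * ⟦ P d ∧ (t d == v) ⟧
  pointwise d with bool-cases (P d) | bool-cases (t d == v)
  ... | inj₂ p | _ rewrite p = z≤n
  ... | inj₁ p | inj₂ q rewrite p | q | *-zeroʳ (w d + 0) = z≤n
  ... | inj₁ p | inj₁ q rewrite p | q = *-monoˡ-≤ 1 (≤-trans (≤-reflexive (+-identityʳ (w d))) (h d p (==⇒≡ q)))

-- Charges of the corners, scaled by 35 and shifted by 7 so as to be natural numbers: a corner at a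
-- vertex of degree k has charge at most 35 (1 - 6/k) + 7, and a corner of a face of length at
-- least 4 receives 17 ≤ 35 / 2 from the face.
α : ℕ → ℕ
α 0 = 0
α 1 = 0
α 2 = 0
α 3 = 0
α 4 = 0
α 5 = 0
α 6 = 7
α (suc (suc (suc (suc (suc (suc (suc k))))))) = 12

-- The bound α k ≤ 42 - 210 / k cleared of its denominator: an equality for k = 5, 6, 7, with slack
-- 30 for every further dart.
vertex-charge : ∀ k → 5 ≤ k → 210 + α k * k ≤ 42 * k
vertex-charge 5 _ = ≤-refl
vertex-charge 6 _ = ≤-refl
vertex-charge (suc (suc (suc (suc (suc (suc (suc k))))))) _ = ≤-trans (m≤m+n _ (30 * k)) (≤-reflexive (solve (k ∷ [])))
vertex-charge 0 ()
vertex-charge 1 (s≤s ())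
vertex-charge 2 (s≤s (s≤s ()))
vertex-charge 3 (s≤s (s≤s (s≤s ())))
vertex-charge 4 (s≤s (s≤s (s≤s (s≤s ()))))

α≥7 : ∀ {k} → 6 ≤ k → 7 ≤ α k
α≥7 {suc (suc (suc (suc (suc (suc zero)))))} _ = ≤-refl
α≥7 {suc (suc (suc (suc (suc (suc (suc k))))))} _ = m≤m+n 7 5
α≥7 {5} (s≤s (s≤s (s≤s (s≤s (s≤s ())))))
α≥7 {4} (s≤s (s≤s (s≤s (s≤s ()))))
α≥7 {3} (s≤s (s≤s (s≤s ())))
α≥7 {2} (s≤s (s≤s ()))
α≥7 {1} (s≤s ())

α≥12 : ∀ {k} → 7 ≤ k → 12 ≤ α k
α≥12 (s≤s (s≤s (s≤s (s≤s (s≤s (s≤s (s≤s h))))))) = ≤-refl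

-- A corner of degree at most 5 contributes nothing but forces 12 + 12 from the other two; without
-- such a corner the sum is at least 7 + 7 + 7.
triangle-charge : ∀ x y z → (x ≤ 5 → 7 ≤ y × 7 ≤ z) → (y ≤ 5 → 7 ≤ x × 7 ≤ z) → (z ≤ 5 → 7 ≤ x × 7 ≤ y) →
  21 ≤ α x + α y + α z
triangle-charge x y z hx hy hz with x ≤? 5 | y ≤? 5 | z ≤? 5
... | yes p | _ | _ = ≤-trans (m≤m+n 21 3) (+-mono-≤ (≤-trans (α≥12 (proj₁ (hx p))) (m≤n+m _ (α x))) (α≥12 (proj₂ (hx p))))
... | no _ | yes p | _ = ≤-trans (m≤m+n 21 3) (+-mono-≤ (≤-trans (α≥12 (proj₁ (hy p))) (m≤m+n _ _)) (α≥12 (proj₂ (hy p))))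
... | no _ | no _ | yes p = ≤-trans (m≤m+n 21 3) (≤-trans (+-mono-≤ (α≥12 (proj₁ (hz p))) (α≥12 (proj₂ (hz p)))) (m≤m+n _ _))
... | no p | no q | no r = +-mono-≤ (+-mono-≤ (α≥7 (≰⇒> p)) (α≥7 (≰⇒> q))) (α≥7 (≰⇒> r))

module _ (D : DartGraph) where
  open DartGraph D

  degree : (Fin darts → Bool) → Fin vertices → ℕ
  degree live v = count (λ d → live d ∧ (tail d == v))

  hasDart : Fin vertices → Bool
  hasDart v = some (λ d → tail d == v)

  module Discharge {live : Fin darts → Bool} {i₀ : ℕ} (E : SubEmbedding D live i₀)
    (i₀-bound : i₀ ≤ count (λ v → not (hasDart v)))
    (min5 : ∀ d → live d ≡ true → 5 ≤ degree live (tail d))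
    (noLight : ∀ d → live d ≡ true → degree live (tail d) ≤ 5 → 7 ≤ degree live (tail (rev d))) where
    open SubEmbedding E

    deg : Fin vertices → ℕ
    deg = degree live

    φ : Permutation′ darts
    φ = permutation rev rev rev-invol rev-invol ∘ₚ ρ

    next : Fin darts → Fin darts
    next x = φ ⟨$⟩ʳ x

    next-live : ∀ {d} → live d ≡ true → live (next d) ≡ true
    next-live l = ρ-live _ (live-rev _ l)

    next-tail : ∀ d → tail (next d) ≡ tail (rev d)
    next-tail d = ρ-tail (rev d)

    next¹ : ∀ d → next d ≢ d
    next¹ d e = loopless d (trans (sym (next-tail d)) (cong tail e))

    -- A face of length two would make `next d` and `rev d` parallel, hence equal, so `rev d` would
    -- be the only live dart at its tail, against minimum degree 5.
    next² : ∀ {d} → live d ≡ true → next (next d) ≢ d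
    next² {d} l e = linear-⊥ 3 (≤-trans (min5 (rev d) (live-rev d l)) (count-≤1 unique)) refl
      where
      next≡rev : next d ≡ rev d
      next≡rev = simple _ _ (next-tail d) (trans (sym (next-tail (next d))) (trans (cong tail e) (cong tail (sym (rev-invol d)))))
      only : ∀ i → live i ∧ (tail i == tail (rev d)) ≡ true → rev d ≡ i
      only i h = fixed-orbit next≡rev (ρ-cycle (rev d) i (live-rev d l) (∧-projₗ h) (sym (==⇒≡ (∧-projᵣ {live i} h))))
      unique : ∀ i j → live i ∧ (tail i == tail (rev d)) ≡ true → live j ∧ (tail j == tail (rev d)) ≡ true → i ≡ j
      unique i j p q = trans (sym (only i p)) (only j q)

    isTriangle : Fin darts → Bool
    isTriangle d = next (next (next d)) == d

    β : Fin darts → ℕ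
    β d = if isTriangle d then 0 else 17

    onFace : Fin F → Fin darts → Bool
    onFace f d = live d ∧ (face d == f)

    next-onFace : ∀ {f d} → onFace f d ≡ true → onFace f (next d) ≡ true
    next-onFace {f} {d} h = ∧-intro (next-live (∧-projₗ h)) (≡⇒== (trans (face-next d (∧-projₗ h)) (==⇒≡ (∧-projᵣ {live d} h))))

    -- A label may cover several face orbits, so its darts are only bounded below, by the first
    -- steps of the walk from d.
    face-size : ∀ {f d} → onFace f d ≡ true → 3 + (if isTriangle d then 0 else 1) ≤ count (onFace f)
    face-size {f} {d} h = ≤-trans (s≤s (s≤s (s≤s fourth))) (≤-reflexive (sym (trans (count-∖ P d h) (cong suc (trans (count-∖ (P ∖ d) d₁ in₁) (cong suc (count-∖ (P ∖ d ∖ d₁) d₂ in₂)))))))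
      where
      P = onFace f
      d₁ = next d
      d₂ = next d₁
      d₃ = next d₂
      l : live d ≡ true
      l = ∧-projₗ h
      d₂≢d₁ : d₂ ≢ d₁
      d₂≢d₁ = next¹ d₁
      in₁ : (P ∖ d) d₁ ≡ true
      in₁ = ∖-intro {P = P} (next-onFace h) (next¹ d)
      in₂ : (P ∖ d ∖ d₁) d₂ ≡ true
      in₂ = ∖-intro {P = P ∖ d} (∖-intro {P = P} (next-onFace (next-onFace h)) (next² l)) d₂≢d₁
      fourth : (if isTriangle d then 0 else 1) ≤ count (P ∖ d ∖ d₁ ∖ d₂)
      fourth with bool-cases (isTriangle d)
      ... | inj₁ t rewrite t = z≤n
      ... | inj₂ t rewrite t = count-member d₃ (∖-intro {P = P ∖ d ∖ d₁} (∖-intro {P = P ∖ d} (∖-intro {P = P}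
              (next-onFace (next-onFace (next-onFace h))) (==-false t)) (next² (next-live l))) (next¹ d₂))

    active : Fin vertices → Bool
    active v = some (λ d → live d ∧ (tail d == v))

    bared : Fin vertices → Bool
    bared v = not (active v) ∧ hasDart v

    A B : ℕ
    A = sum (λ d → ⟦ live d ⟧ * α (deg (tail d)))
    B = sum (λ d → ⟦ live d ⟧ * β d)

    M-fibres : ∀ {k} (t : Fin darts → Fin k) → count live ≡ sum (λ v → count (λ d → live d ∧ (t d == v)))
    M-fibres t = trans (count-def live) (trans (∑-fibre t (λ d → ⟦ live d ⟧)) (sum-cong-≗ (fibre-count t live)))

    vertex-total : 210 * count active + A ≤ 42 * count live
    vertex-total = begin
      210 * count active + A                                               ≡⟨ cong₂ _+_ (trans (cong (210 *_) (count-def active)) (sym (∑-*ˡ 210 (λ v → ⟦ active v ⟧)))) (∑-fibre tail w) ⟩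
      sum (λ v → 210 * ⟦ active v ⟧) + sum (fibre tail w)                  ≡⟨ ∑-distrib-+ (λ v → 210 * ⟦ active v ⟧) (fibre tail w) ⟨
      sum (λ v → 210 * ⟦ active v ⟧ + fibre tail w v)                      ≤⟨ ∑-mono at-vertex ⟩
      sum (λ v → 42 * deg v)                                               ≡⟨ ∑-*ˡ 42 deg ⟩
      42 * sum deg                                                         ≡⟨ cong (42 *_) (M-fibres tail) ⟨
      42 * count live                                                      ∎
      where
      open ≤-Reasoning
      w : Fin darts → ℕ
      w d = ⟦ live d ⟧ * α (deg (tail d))
      w≤ : ∀ v → fibre tail w v ≤ α (deg v) * deg v
      w≤ v = fibre-bound tail live (λ d → α (deg (tail d))) v (α (deg v)) (λ d _ e → ≤-reflexive (cong (α ∘ deg) e))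
      at-vertex : ∀ v → 210 * ⟦ active v ⟧ + fibre tail w v ≤ 42 * deg v
      at-vertex v with bool-cases (active v)
      ... | inj₁ a with some-elim a
      ...   | d , h = ≤-trans (+-mono-≤ (≤-reflexive (cong (λ b → 210 * ⟦ b ⟧) a)) (w≤ v))
                (vertex-charge (deg v) (subst (λ z → 5 ≤ deg z) (==⇒≡ (∧-projᵣ {live d} h)) (min5 d (∧-projₗ h))))
      at-vertex v | inj₂ a = ≤-trans (+-mono-≤ (≤-reflexive (cong (λ b → 210 * ⟦ b ⟧) a)) (≤-trans (w≤ v) (≤-reflexive zero-degree))) z≤n
        where
        zero-degree : α (deg v) * deg v ≡ 0
        zero-degree = trans (cong (α (deg v) *_) (count-empty (λ d → ≢true⇒false (λ h → false≢true a (some-intro d h))))) (*-zeroʳ (α (deg v)))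

    labelled : Maybe (Fin F) → Fin F → Bool
    labelled (just g) f = g == f
    labelled nothing f = false

    bareOn : Fin F → Fin vertices → Bool
    bareOn f v = bared v ∧ labelled (bare v) f

    -- Every dart pays 70 and every bare vertex 210 to its label. Three darts cover the 210 that a
    -- label needs; a fourth one also covers the 17 given back to each corner.
    face-total : 210 * F + B ≤ 70 * count live + 210 * count bared
    face-total = begin
      210 * F + B                                                          ≡⟨ cong₂ _+_ (trans (*-comm 210 F) (sym (∑-const {F} 210))) (∑-fibre face w) ⟩
      sum {F} (λ f → 210) + sum (fibre face w)                             ≡⟨ ∑-distrib-+ (λ f → 210) (fibre face w) ⟨
      sum (λ f → 210 + fibre face w f)                                     ≤⟨ ∑-mono at-face ⟩
      sum (λ f → 70 * count (onFace f) + 210 * count (bareOn f))           ≡⟨ ∑-distrib-+ (λ f → 70 * count (onFace f)) (λ f → 210 * count (bareOn f)) ⟩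
      sum (λ f → 70 * count (onFace f)) + sum (λ f → 210 * count (bareOn f)) ≡⟨ cong₂ _+_ (∑-*ˡ 70 (λ f → count (onFace f))) (∑-*ˡ 210 (λ f → count (bareOn f))) ⟩
      70 * sum (λ f → count (onFace f)) + 210 * sum (λ f → count (bareOn f)) ≤⟨ +-mono-≤ (≤-reflexive (cong (70 *_) (sym (M-fibres face)))) (*-monoʳ-≤ 210 bare-total) ⟩
      70 * count live + 210 * count bared                                  ∎
      where
      open ≤-Reasoning
      w : Fin darts → ℕ
      w d = ⟦ live d ⟧ * β d

      bare-total : sum (λ f → count (bareOn f)) ≤ count bared
      bare-total = begin
        sum (λ f → count (bareOn f))                 ≡⟨ sum-cong-≗ (λ f → count-def (bareOn f)) ⟩
        sum (λ f → sum (λ v → ⟦ bareOn f v ⟧))       ≡⟨ ∑-comm (λ f v → ⟦ bareOn f v ⟧) ⟩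
        sum (λ v → sum (λ f → ⟦ bareOn f v ⟧))       ≤⟨ ∑-mono at-vertex ⟩
        sum (λ v → ⟦ bared v ⟧)                      ≡⟨ count-def bared ⟨
        count bared                                  ∎
        where
        label-unique : ∀ x f g → labelled x f ≡ true → labelled x g ≡ true → f ≡ g
        label-unique (just h) f g p q = trans (sym (==⇒≡ p)) (==⇒≡ q)
        at-vertex : ∀ v → sum (λ f → ⟦ bareOn f v ⟧) ≤ ⟦ bared v ⟧
        at-vertex v with bool-cases (bared v)
        ... | inj₁ b = ≤-trans (≤-reflexive (sym (count-def (λ f → bareOn f v))))
                (≤-trans (count-≤1 (λ f g p q → label-unique (bare v) f g (∧-projᵣ {bared v} p) (∧-projᵣ {bared v} q))) (≤-reflexive (sym (cong ⟦_⟧ b))))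
        ... | inj₂ b = ≤-trans (≤-reflexive (trans (sym (count-def (λ f → bareOn f v))) (count-empty (λ f → cong (_∧ labelled (bare v) f) b)))) z≤n

      β≤17 : ∀ d → β d ≤ 17
      β≤17 d with isTriangle d
      ... | true = z≤n
      ... | false = ≤-refl

      w≤17 : ∀ f → fibre face w f ≤ 17 * count (onFace f)
      w≤17 f = fibre-bound face live β f 17 (λ d _ _ → β≤17 d)

      at-bare-face : ∀ s b x → x ≤ 17 * s → 1 ≤ b → 210 + x ≤ 70 * s + 210 * b
      at-bare-face s b x h₁ h₂ = ≤-trans (+-mono-≤ (*-monoʳ-≤ 210 h₂) (≤-trans h₁ (*-monoˡ-≤ s (m≤m+n 17 53)))) (≤-reflexive (+-comm (210 * b) (70 * s)))

      -- Here 70 = 53 + 17, and 53 · 4 = 212 covers 210.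
      at-large-face : ∀ s b x → x ≤ 17 * s → 4 ≤ s → 210 + x ≤ 70 * s + 210 * b
      at-large-face s b x h₁ h₂ = ≤-trans (+-mono-≤ (≤-trans (m≤m+n 210 2) (*-monoʳ-≤ 53 h₂)) h₁)
        (≤-trans (≤-reflexive (sym (*-distribʳ-+ s 53 17))) (m≤m+n _ _))

      at-triangle : ∀ s b x → x ≤ 0 * s → 3 ≤ s → 210 + x ≤ 70 * s + 210 * b
      at-triangle s b x h₁ h₂ = ≤-trans (+-mono-≤ (*-monoʳ-≤ 70 h₂) h₁) (≤-trans (≤-reflexive (+-identityʳ (70 * s))) (m≤m+n _ _))

      at-face : ∀ f → 210 + fibre face w f ≤ 70 * count (onFace f) + 210 * count (bareOn f)
      at-face f with witness f
      -- The bare vertex is the tail of a dart, so it is counted by `bared` and not among the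
      -- dartless vertices that bound i₀.
      ... | inj₂ (d , iso , e) = at-bare-face (count (onFace f)) (count (bareOn f)) (fibre face w f) (w≤17 f) (count-member {P = bareOn f} (tail d)
              (∧-intro (∧-intro (not-intro (≢true⇒false no-live)) (some-intro d (≡⇒== refl))) (trans (cong (λ x → labelled x f) e) (≡⇒== refl))))
        where
        no-live : active (tail d) ≡ true → ⊥
        no-live a with some-elim a
        ... | d′ , h = iso d′ (∧-projₗ h) (==⇒≡ (∧-projᵣ {live d′} h))
      ... | inj₁ (d , l , e) with search (λ d → onFace f d ∧ not (isTriangle d))
      ... | inj₁ (d′ , h) = at-large-face (count (onFace f)) (count (bareOn f)) (fibre face w f) (w≤17 f) (≤-trans (≤-reflexive (cong (λ b → 3 + (if b then 0 else 1))
              (sym (not-elim (∧-projᵣ {onFace f d′} h))))) (face-size {f} {d′} (∧-projₗ h)))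
      ... | inj₂ none = at-triangle (count (onFace f)) (count (bareOn f)) (fibre face w f) (fibre-bound face live β f 0 no-charge)
              (≤-trans (m≤m+n 3 _) (face-size {f} {d} (∧-intro l (≡⇒== e))))
        where
        no-charge : ∀ d → live d ≡ true → face d ≡ f → β d ≤ 0
        no-charge d l e with bool-cases (isTriangle d)
        ... | inj₁ t = ≤-reflexive (cong (λ b → if b then 0 else 17) t)
        ... | inj₂ t = ⊥-elim (false≢true (none d) (∧-intro (∧-intro l (≡⇒== e)) (not-intro t)))

    noLight-rev : ∀ d → live d ≡ true → deg (tail (rev d)) ≤ 5 → 7 ≤ deg (tail d)
    noLight-rev d l h = subst (λ z → 7 ≤ deg (tail z)) (rev-invol d) (noLight (rev d) (live-rev d l) h)

    -- Instead of grouping corners by faces, each dart is added to its two successors; `next` is a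
    -- permutation, so every charge is counted three times. On a triangle the three corners carry
    -- 21, and elsewhere the dart alone has 3 · 17.
    corner-total : 7 * count live ≤ A + B
    corner-total = *-cancelˡ-≤ 3 (begin
      3 * (7 * count live)                                ≡⟨ sym (*-assoc 3 7 (count live)) ⟩
      21 * count live                                     ≡⟨ trans (cong (21 *_) (count-def live)) (sym (∑-*ˡ 21 (λ d → ⟦ live d ⟧))) ⟩
      sum (λ d → 21 * ⟦ live d ⟧)                         ≤⟨ ∑-mono at-dart ⟩
      sum (λ d → (a d + a (next d) + a (next (next d))) + 3 * b d)   ≡⟨ ∑-distrib-+ (λ d → a d + a (next d) + a (next (next d))) (λ d → 3 * b d) ⟩
      sum (λ d → a d + a (next d) + a (next (next d))) + sum (λ d → 3 * b d)   ≡⟨ cong₂ _+_ three-A (∑-*ˡ 3 b) ⟩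
      (A + A + A) + 3 * B                                 ≡⟨ rearrange A B ⟩
      3 * (A + B)                                         ∎)
      where
      open ≤-Reasoning
      a b : Fin darts → ℕ
      a d = ⟦ live d ⟧ * α (deg (tail d))
      b d = ⟦ live d ⟧ * β d

      rearrange : ∀ A B → (A + A + A) + 3 * B ≡ 3 * (A + B)
      rearrange A B = solve (A ∷ B ∷ [])

      three-A : sum (λ d → a d + a (next d) + a (next (next d))) ≡ A + A + A
      three-A = trans (∑-distrib-+ (λ d → a d + a (next d)) (λ d → a (next (next d))))
        (cong₂ _+_ (trans (∑-distrib-+ a (a ∘ next)) (cong (A +_) (sym (∑-permute a φ))))
                   (trans (sym (∑-permute (a ∘ next) φ)) (sym (∑-permute a φ))))

      a-live : ∀ {d} → live d ≡ true → α (deg (tail d)) ≤ a d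
      a-live {d} l = ≤-reflexive (sym (trans (cong (λ b → ⟦ b ⟧ * α (deg (tail d))) l) (+-identityʳ _)))

      at-dart : ∀ d → 21 * ⟦ live d ⟧ ≤ (a d + a (next d) + a (next (next d))) + 3 * b d
      at-dart d with bool-cases (live d)
      ... | inj₂ l = ≤-trans (≤-reflexive (cong (λ b → 21 * ⟦ b ⟧) l)) z≤n
      ... | inj₁ l with bool-cases (isTriangle d)
      ... | inj₂ t = ≤-trans (≤-trans (*-monoʳ-≤ 21 (⟦⟧≤1 (live d))) (≤-trans (m≤m+n 21 30)
              (≤-reflexive (sym (cong₂ (λ x y → 3 * (⟦ x ⟧ * (if y then 0 else 17))) l t))))) (m≤n+m (3 * b d) (a d + a (next d) + a (next (next d))))
      ... | inj₁ t = ≤-trans (*-monoʳ-≤ 21 (⟦⟧≤1 (live d))) (≤-trans (triangle-charge (deg (tail d)) (deg (tail d₁)) (deg (tail d₂))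
              (λ h → (subst (λ z → 7 ≤ deg z) (sym (next-tail d)) (noLight d l h)) , noLight-rev d₂ l₂ (subst (λ z → deg z ≤ 5) (sym closing) h))
              (λ h → noLight-rev d l (subst (λ z → deg z ≤ 5) (next-tail d) h) , subst (λ z → 7 ≤ deg z) (sym (next-tail d₁)) (noLight d₁ l₁ h))
              (λ h → subst (λ z → 7 ≤ deg z) closing (noLight d₂ l₂ h) , noLight-rev d₁ l₁ (subst (λ z → deg z ≤ 5) (next-tail d₁) h)))
              (≤-trans (+-mono-≤ (+-mono-≤ (a-live l) (a-live l₁)) (a-live l₂)) (m≤m+n _ _)))
        where
        d₁ = next d
        d₂ = next d₁
        l₁ : live d₁ ≡ true
        l₁ = next-live l
        l₂ : live d₂ ≡ true
        l₂ = next-live l₁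
        closing : tail (rev d₂) ≡ tail d
        closing = trans (sym (next-tail d₂)) (cong tail (==⇒≡ t))

    -- An inactive vertex reaches only itself and so has a component label of its own; the tail of
    -- the live dart needs one more.
    component-total : ∀ d → live d ≡ true → suc (count (not ∘ active)) ≤ c
    component-total d₀ l₀ = begin
      suc (count (not ∘ active))                               ≡⟨ trans (+-comm 1 _) (cong (count (not ∘ active) +_) (sym (count-single u))) ⟩
      count (not ∘ active) + count (λ v → v == u)              ≡⟨ count-disjoint (not ∘ active) (λ v → v == u) (λ v p q → false≢true (not-elim p) (subst (λ z → active z ≡ true) (sym (==⇒≡ q)) active-u)) ⟩
      count Q                                                  ≤⟨ count-relation Q (λ _ → true) (λ v k → comp v == k) (λ v _ → comp v , refl , ≡⇒== refl)
                                                                   (λ k v v′ _ q q′ r r′ → same v v′ q q′ (trans (==⇒≡ r) (sym (==⇒≡ r′)))) ⟩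
      count {c} (λ _ → true)                                   ≡⟨ count-full ⟩
      c                                                        ∎
      where
      open ≤-Reasoning
      u = tail d₀
      Q : Fin vertices → Bool
      Q v = not (active v) ∨ (v == u)
      active-u : active u ≡ true
      active-u = some-intro d₀ (∧-intro l₀ (≡⇒== refl))
      stuck : ∀ {v w} → active v ≡ false → Reach D live v w → v ≡ w
      stuck a ε = refl
      stuck a ((d , l , e , _) ◅ _) = ⊥-elim (false≢true a (some-intro d (∧-intro l (≡⇒== e))))
      same : ∀ v v′ → Q v ≡ true → Q v′ ≡ true → comp v ≡ comp v′ → v ≡ v′
      same v v′ q q′ e with ∨-elim {not (active v)} q | ∨-elim {not (active v′)} q′
      ... | inj₁ a | _ = stuck (not-elim a) (comp-conn v v′ e)
      ... | inj₂ _ | inj₁ a = sym (stuck (not-elim a) (comp-conn v′ v (sym e)))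
      ... | inj₂ p | inj₂ p′ = trans (==⇒≡ p) (sym (==⇒≡ p′))

    contradiction : ∀ d → live d ≡ true → ⊥
    contradiction d l = arith c (count live) vertices F i₀ (count active) (count (not ∘ active)) (count bared) (count (λ v → not (active v) ∧ not (hasDart v))) A B
      euler (component-total d l) (≤-trans i₀-bound (count-mono unused)) (≤-reflexive (sym (count-split (not ∘ active) hasDart))) (≤-reflexive (sym (count-not active)))
      vertex-total face-total corner-total
      where
      unused : ∀ v → not (hasDart v) ≡ true → not (active v) ∧ not (hasDart v) ≡ true
      unused v h = ∧-intro (not-intro (≢true⇒false no-live)) h
        where
        no-live : active v ≡ true → ⊥
        no-live a with some-elim a
        ... | d , p = false≢true (not-elim h) (some-intro d (∧-projᵣ {live d} p))

      arith : ∀ c M n F i₀ nA i j z A B → 4 * c + M ≤ 2 * (n + F + i₀) → suc i ≤ c → i₀ ≤ z → j + z ≤ i → n ≤ nA + i →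
        210 * nA + A ≤ 42 * M → 210 * F + B ≤ 70 * M + 210 * j → 7 * M ≤ A + B → ⊥
      -- The dart terms cancel, since 42 + 70 - 7 = 105. Each inactive vertex costs 420 through c
      -- and returns 210 through n and 210 through j + z; the component of the live dart leaves the
      -- excess 420 = suc 419.
      arith c M n F i₀ nA i j z A B h₁ h₂ h₃ h₄ h₅ h₆ h₇ h₈ =
        linear-⊥ 419 (+-mono-≤ (scale 105 h₁) (+-mono-≤ (scale 420 h₂) (+-mono-≤ (scale 210 h₃)
          (+-mono-≤ (scale 210 h₄) (+-mono-≤ (scale 210 h₅) (+-mono-≤ h₆ (+-mono-≤ h₇ h₈)))))))
          (solve (c ∷ M ∷ n ∷ F ∷ i₀ ∷ nA ∷ i ∷ j ∷ z ∷ A ∷ B ∷ []))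

-- Light configurations and packings

sum-tabulate : ∀ (f : Fin n → ℕ) → ListAction.sum (tabulate f) ≡ sum f
sum-tabulate {zero} f = refl
sum-tabulate {suc n} f = cong (f zero +_) (sum-tabulate (f ∘ suc))

sum-allFin : ∀ (f : Fin n → ℕ) → ListAction.sum (map f (allFin n)) ≡ sum f
sum-allFin f = trans (cong ListAction.sum (map-tabulate id f)) (sum-tabulate f)

-- Colours left free by the neighbours

opaque
  -- Row i stands for the i-th colouring and column a for a colour; each d in N strikes out one
  -- column per row and, when `g d` is injective, at most one row per column.
  allowed : (Fin m → Bool) → (Fin m → Fin n → Fin n) → Matrix n
  allowed N g i a = not (some (λ d → N d ∧ (g d i == a)))

  allowed-≢ : ∀ {N : Fin m → Bool} {g : Fin m → Fin n → Fin n} {i a} → allowed N g i a ≡ true → ∀ d → N d ≡ true → g d i ≢ a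
  allowed-≢ h d p e = false≢true (not-elim h) (some-intro d (∧-intro p (≡⇒== e)))

  allowed-intro : ∀ {N : Fin m → Bool} {g : Fin m → Fin n → Fin n} {i a} → (∀ d → N d ≡ true → g d i ≢ a) → allowed N g i a ≡ true
  allowed-intro {N = N} h = not-intro (≢true⇒false (λ s → let d , p = some-elim s in h d (∧-projₗ p) (==⇒≡ (∧-projᵣ {N d} p))))

  count-allowed : ∀ {N : Fin m → Bool} k → k + count N ≤ n → (F : Fin n → Bool) → count F ≤ count N → k ≤ count (not ∘ F)
  count-allowed {N = N} k le F F≤N = +-cancelʳ-≤ (count N) k _ (≤-trans le (≤-trans (≤-reflexive (sym (count-not F)))
      (≤-trans (+-monoˡ-≤ _ F≤N) (≤-reflexive (+-comm (count N) _)))))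

  allowed-rows : ∀ {N : Fin m → Bool} {g : Fin m → Fin n → Fin n} k → k + count N ≤ n → RowDegrees≥ k (allowed N g)
  allowed-rows {N = N} {g} k le i = count-allowed k le (λ a → some (λ d → N d ∧ (g d i == a)))
      (count-relation _ N (λ a d → g d i == a) (λ a s → let d , p = some-elim s in d , ∧-projₗ p , ∧-projᵣ {N d} p)
        (λ d a a′ _ _ _ r r′ → trans (sym (==⇒≡ r)) (==⇒≡ r′)))

  allowed-cols : ∀ {N : Fin m → Bool} {g : Fin m → Fin n → Fin n} k → k + count N ≤ n → (∀ d → N d ≡ true → ∀ {i j} → g d i ≡ g d j → i ≡ j) → RowDegrees≥ k (flip (allowed N g))
  allowed-cols {N = N} {g} k le inj a = count-allowed k le (λ i → some (λ d → N d ∧ (g d i == a)))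
      (count-relation _ N (λ i d → g d i == a) (λ i s → let d , p = some-elim s in d , ∧-projₗ p , ∧-projᵣ {N d} p)
        (λ d i i′ p _ _ r r′ → inj d p (trans (==⇒≡ r) (sym (==⇒≡ r′)))))

module _ (G : Graph) (P : PlanarEmbedding G) where
  open Graph G renaming (n to order; sym to adj-sym)
  open PlanarEmbedding P renaming (m to dartCount)

  dartGraph : DartGraph
  dartGraph = record
    { vertices = order ; darts = dartCount ; tail = tail ; rev = rev ; rev-invol = rev-invol
    ; loopless = λ d e → false≢true (irrefl (tail d)) (trans (cong (adj (tail d)) (sym e)) (dart-adj d))
    ; simple = dart-inj }

  isolated-bound : isolatedCount G ≤ count (λ v → not (hasDart dartGraph v))
  isolated-bound = ≤-trans (≤-reflexive (sum-allFin (λ u → if hasNeighbour G u then 0 else 1)))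
    (≤-trans (∑-mono pointwise) (≤-reflexive (sym (count-def (λ v → not (hasDart dartGraph v))))))
    where
    neighbour : ∀ u w → Adj G u w → hasNeighbour G u ≡ true
    neighbour u w a = Equivalence.to T-≡ (any⁺ (adj u) (lose (∈-allFin w) (Equivalence.from T-≡ a)))
    pointwise : ∀ u → (if hasNeighbour G u then 0 else 1) ≤ ⟦ not (hasDart dartGraph u) ⟧
    pointwise u with bool-cases (hasDart dartGraph u)
    ... | inj₂ h = ≤-trans (if-≤1 (hasNeighbour G u)) (≤-reflexive (sym (cong (λ b → ⟦ not b ⟧) h)))
      where
      if-≤1 : ∀ b → (if b then 0 else 1) ≤ 1
      if-≤1 true = z≤n
      if-≤1 false = ≤-refl
    ... | inj₁ h with some-elim h
    ...   | d , e = ≤-trans (≤-reflexive (cong (λ b → if b then 0 else 1)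
              (neighbour u (tail (rev d)) (subst (λ z → Adj G z (tail (rev d))) (==⇒≡ e) (dart-adj d))))) z≤n

  embedding : SubEmbedding dartGraph (λ _ → true) (isolatedCount G)
  embedding = record
    { live-rev = λ _ _ → refl
    ; ρ = rot
    ; ρ-tail = rot-tail
    ; ρ-live = λ _ _ → refl
    ; ρ-cycle = λ d d′ _ _ e → rot-cycle d d′ e
    ; F = F
    ; face = face
    ; face-next = λ d _ → sym (Equivalence.from (face-orbit d _) (refl ◅ ε))
    ; bare = λ _ → nothing
    ; witness = λ f → inj₁ (proj₁ (face-surj f) , refl , proj₂ (face-surj f))
    ; c = c
    ; comp = comp
    ; comp-conn = λ u v e → Star.map (λ {u} {v} a → let d , t , h = dart-surj u v a in d , refl , t , h) (Equivalence.to (comp-conn u v) e)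
    ; euler = ≤-reflexive (trans (cong (4 * c +_) count-full) (sym euler))
    }

  within : (Fin order → Bool) → Fin dartCount → Bool
  within W d = W (tail d) ∧ W (tail (rev d))

  within-rev : ∀ W d → within W d ≡ true → within W (rev d) ≡ true
  within-rev W d h = ∧-intro (∧-projᵣ {W (tail d)} h) (trans (cong (W ∘ tail) (rev-invol d)) (∧-projₗ h))

  deg : (Fin order → Bool) → Fin order → ℕ
  deg W = degree dartGraph (within W)

  LightVertex LightEdge : (Fin order → Bool) → Set
  LightVertex W = Σ (Fin order) λ u → W u ≡ true × deg W u ≤ 4
  LightEdge W = Σ (Fin dartCount) λ d → within W d ≡ true × deg W (tail d) ≤ 5 × deg W (tail (rev d)) ≤ 6

  opaque
    light : ∀ W u → W u ≡ true → LightVertex W ⊎ LightEdge W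
    light W u Wu with search (λ v → W v ∧ does (deg W v ≤? 4))
    ... | inj₁ (v , h) = inj₁ (v , ∧-projₗ h , does-true (deg W v ≤? 4) (∧-projᵣ {W v} h))
    ... | inj₂ noVertex with search (λ d → within W d ∧ (does (deg W (tail d) ≤? 5) ∧ does (deg W (tail (rev d)) ≤? 6)))
    ... | inj₁ (d , h) = inj₂ (d , ∧-projₗ h , does-true (_ ≤? 5) (∧-projₗ h′) , does-true (_ ≤? 6) (∧-projᵣ {does (deg W (tail d) ≤? 5)} h′))
      where
      h′ : does (deg W (tail d) ≤? 5) ∧ does (deg W (tail (rev d)) ≤? 6) ≡ true
      h′ = ∧-projᵣ {within W d} h
    -- Both decidable searches have failed, so only a contradiction is wanted and the double
    -- negation in `restrict` does no harm.
    ... | inj₂ noEdge = ⊥-elim (restrict dartGraph (within W) (within-rev W) _ (λ _ → true) embedding ≤-refl (λ _ _ → refl) refute)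
      where
      min5 : ∀ v → W v ≡ true → 5 ≤ deg W v
      min5 v w = ≰⇒> λ le → false≢true (noVertex v) (∧-intro w (dec-true (deg W v ≤? 4) le))
      noLight : ∀ d → within W d ≡ true → deg W (tail d) ≤ 5 → 7 ≤ deg W (tail (rev d))
      noLight d h le = ≰⇒> λ le′ → false≢true (noEdge d) (∧-intro h (∧-intro (dec-true (_ ≤? 5) le) (dec-true (_ ≤? 6) le′)))
      refute : (Σ (Fin dartCount → Bool) λ live → (∀ d → live d ≡ within W d) × SubEmbedding dartGraph live (isolatedCount G)) → ⊥
      refute (live , agree , E) = Discharge.contradiction dartGraph E isolated-bound
        (λ d l → ≤-trans (min5 (tail d) (∧-projₗ (trans (sym (agree d)) l))) (≤-reflexive (sym (same (tail d)))))
        (λ d l le → ≤-trans (noLight d (trans (sym (agree d)) l) (≤-trans (≤-reflexive (sym (same (tail d)))) le)) (≤-reflexive (sym (same (tail (rev d))))))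
        d₀ (trans (agree d₀) (∧-projₗ (proj₂ someDart)))
        where
        same : ∀ v → degree dartGraph live v ≡ deg W v
        same v = count-cong (λ d → cong (_∧ (tail d == v)) (agree d))
        someDart : ∃ λ d → within W d ∧ (tail d == u) ≡ true
        someDart = count-pos _ (≤-trans (s≤s z≤n) (min5 u Wu))
        d₀ : Fin dartCount
        d₀ = proj₁ someDart

  Colours : Set
  Colours = Fin order → Fin 8 → Fin 8

  -- Extending packings by a light vertex or a light edge

  module Colouring (C : Cover G 8) where
    open Cover C renaming (D to orientation)
    open Orientation orientation

    -- the colour of w that conflicts with a given colour of v
    opaque
      τ : Fin order → Fin order → Fin 8 → Fin 8
      τ v w a = if arc v w then σ v w ⟨$⟩ʳ a else σ w v ⟨$⟩ˡ a

      τ-arc : ∀ {v w} → arc v w ≡ true → ∀ a → τ v w a ≡ σ v w ⟨$⟩ʳ a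
      τ-arc {v} {w} e a = cong (λ b → if b then σ v w ⟨$⟩ʳ a else σ w v ⟨$⟩ˡ a) e

      τ-coarc : ∀ {v w} → arc w v ≡ true → ∀ a → τ v w a ≡ σ w v ⟨$⟩ˡ a
      τ-coarc {v} {w} e a = cong (λ b → if b then σ v w ⟨$⟩ʳ a else σ w v ⟨$⟩ˡ a) (arc-asym w v e)

    τ-inverse : ∀ {v w} → Adj G v w → ∀ a → τ w v (τ v w a) ≡ a
    τ-inverse {v} {w} adjacent a with adj-arc v w adjacent
    ... | inj₁ e = trans (cong (τ w v) (τ-arc e a)) (trans (τ-coarc e _) (inverseˡ (σ v w)))
    ... | inj₂ e = trans (cong (τ w v) (τ-coarc e a)) (trans (τ-arc e _) (inverseʳ (σ w v)))

    τ-injective : ∀ {v w} → Adj G v w → ∀ {a b} → τ v w a ≡ τ v w b → a ≡ b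
    τ-injective {v} {w} adjacent e = trans (sym (τ-inverse adjacent _)) (trans (cong (τ w v) e) (τ-inverse adjacent _))

    adjacent-sym : ∀ {v w} → Adj G v w → Adj G w v
    adjacent-sym {v} {w} = trans (adj-sym w v)

    Compatible : Fin order → Fin order → (Fin 8 → Fin 8) → (Fin 8 → Fin 8) → Set
    Compatible v w f g = ∀ i → τ v w (f i) ≢ g i

    compatible-sym : ∀ {v w f g} → Adj G v w → Compatible v w f g → Compatible w v g f
    compatible-sym {v} {w} adjacent h i e = h i (trans (cong (τ v w) (sym e)) (τ-inverse (adjacent-sym adjacent) _))

    record PackingOn (W : Fin order → Bool) (φ : Colours) : Set where
      field
        injective  : ∀ v → W v ≡ true → ∀ {i j} → φ v i ≡ φ v j → i ≡ j
        compatible : ∀ v w → W v ≡ true → W w ≡ true → Adj G v w → Compatible v w (φ v) (φ w)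

    open PackingOn

    opaque
      recolour : Colours → Fin order → (Fin 8 → Fin 8) → Colours
      recolour φ u f v = if v == u then f else φ v

      recolour-at : ∀ φ u f → recolour φ u f u ≡ f
      recolour-at φ u f = cong (λ b → if b then f else φ u) (≡⇒== refl)

      recolour-off : ∀ φ u f {v} → v ≢ u → recolour φ u f v ≡ φ v
      recolour-off φ u f {v} ne = cong (λ b → if b then f else φ v) (≢⇒== ne)

      extend : ∀ {W φ} u f → PackingOn (W ∖ u) φ → (∀ {i j} → f i ≡ f j → i ≡ j) →
        (∀ w → (W ∖ u) w ≡ true → Adj G w u → Compatible w u (φ w) f) → PackingOn W (recolour φ u f)
      extend {W} {φ} u f pack inj comp-u = record { injective = injective′ ; compatible = compatible′ }
        where
        injective′ : ∀ v → W v ≡ true → ∀ {i j} → recolour φ u f v i ≡ recolour φ u f v j → i ≡ j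
        injective′ v w e with bool-cases (v == u)
        ... | inj₁ q rewrite q = inj e
        ... | inj₂ q rewrite q = injective pack v (∖-intro {P = W} w (==-false q)) e

        compatible′ : ∀ v w → W v ≡ true → W w ≡ true → Adj G v w → Compatible v w (recolour φ u f v) (recolour φ u f w)
        compatible′ v w Wv Ww adjacent with bool-cases (v == u) | bool-cases (w == u)
        ... | inj₂ p | inj₂ q rewrite p | q =
                compatible pack v w (∖-intro {P = W} Wv (==-false p)) (∖-intro {P = W} Ww (==-false q)) adjacent
        ... | inj₂ p | inj₁ q rewrite p | q with refl ← ==⇒≡ q = comp-u v (∖-intro {P = W} Wv (==-false p)) adjacent
        ... | inj₁ p | inj₂ q rewrite p | q with refl ← ==⇒≡ p =
                compatible-sym (adjacent-sym adjacent) (comp-u w (∖-intro {P = W} Ww (==-false q)) (adjacent-sym adjacent))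
        ... | inj₁ p | inj₁ q with refl ← ==⇒≡ p | refl ← ==⇒≡ q = ⊥-elim (false≢true (irrefl v) adjacent)

    dartsAt : (Fin order → Bool) → Fin order → Fin dartCount → Bool
    dartsAt W u d = within W d ∧ (tail d == u)

    forced : Colours → Fin order → Fin dartCount → Fin 8 → Fin 8
    forced φ u d i = τ (tail (rev d)) u (φ (tail (rev d)) i)

    dart-to : ∀ {W u w} → W u ≡ true → W w ≡ true → Adj G u w → Σ (Fin dartCount) λ d → dartsAt W u d ≡ true × tail (rev d) ≡ w
    dart-to {W} {u} {w} Wu Ww adjacent with dart-surj u w adjacent
    ... | d , refl , refl = d , ∧-intro (∧-intro Wu Ww) (≡⇒== refl) , refl

    head-adjacent : ∀ {W u d} → dartsAt W u d ≡ true → Adj G (tail (rev d)) u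
    head-adjacent {W} {u} {d} h = subst (Adj G (tail (rev d))) (==⇒≡ (∧-projᵣ {within W d} h)) (adjacent-sym (dart-adj d))

    head-in : ∀ {W u d} → dartsAt W u d ≡ true → (W ∖ u) (tail (rev d)) ≡ true
    head-in {W} {u} {d} h = ∖-intro {P = W} (∧-projᵣ {W (tail d)} (∧-projₗ h))
      (λ e → false≢true (irrefl u) (subst (λ z → Adj G z u) e (head-adjacent {W} h)))

    extend-light-vertex : ∀ {W φ} u → W u ≡ true → deg W u ≤ 4 → PackingOn (W ∖ u) φ → Σ Colours (PackingOn W)
    extend-light-vertex {W} {φ} u Wu le pack = recolour φ u f , extend u f pack inj compatible-u
      where
      A : Matrix 8
      A = allowed (dartsAt W u) (forced φ u)
      forced-injective : ∀ d → dartsAt W u d ≡ true → ∀ {i j} → forced φ u d i ≡ forced φ u d j → i ≡ j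
      forced-injective d h e = injective pack _ (head-in {W} h) (τ-injective (head-adjacent {W} h) e)
      M : PerfectMatching A
      M = min-degree-4-matching ≤-refl ≤-refl A (allowed-rows 4 (+-monoʳ-≤ 4 le)) (allowed-cols 4 (+-monoʳ-≤ 4 le) forced-injective)
      f = proj₁ M
      inj : ∀ {i j} → f i ≡ f j → i ≡ j
      inj = proj₁ (proj₂ M)
      compatible-u : ∀ w → (W ∖ u) w ≡ true → Adj G w u → Compatible w u (φ w) f
      compatible-u w h adjacent i with dart-to {W} Wu (∧-projₗ h) (adjacent-sym adjacent)
      ... | d , at , refl = allowed-≢ (proj₂ (proj₂ M) i) d at

    -- The edge uv is left out of both matrices of allowed colours; it is accounted for only by the
    -- disjointness of the two matchings.
    extend-light-edge : ∀ {W φ} d₀ → within W d₀ ≡ true → deg W (tail d₀) ≤ 5 → deg W (tail (rev d₀)) ≤ 6 →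
      PackingOn (W ∖ tail d₀) φ → Σ Colours (PackingOn W)
    extend-light-edge {W} {φ} d₀ live₀ le-u le-v pack =
      recolour φ₁ u f , extend u f (extend v g pack-W∖u∖v g-inj compatible-v) (λ {i} {j} → proj₁ (proj₂ (proj₁ MN)) {i} {j}) compatible-u
      where
      u = tail d₀
      d₁ = rev d₀
      v = tail d₁
      u~v : Adj G u v
      u~v = dart-adj d₀
      v~u : Adj G v u
      v~u = adjacent-sym u~v
      Wu : W u ≡ true
      Wu = ∧-projₗ live₀
      Wv : W v ≡ true
      Wv = ∧-projᵣ {W u} live₀
      v≢u : v ≢ u
      v≢u = DartGraph.loopless dartGraph d₀
      W∖u∖v = W ∖ u ∖ v

      pack-W∖u∖v : PackingOn W∖u∖v φ
      pack-W∖u∖v = record { injective = λ w h → injective pack w (∧-projₗ h)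
                          ; compatible = λ w w′ h h′ → compatible pack w w′ (∧-projₗ h) (∧-projₗ h′) }

      N-u N-v : Fin dartCount → Bool
      N-u = dartsAt W u ∖ d₀
      N-v = dartsAt W v ∖ d₁

      d₀-at : dartsAt W u d₀ ≡ true
      d₀-at = ∧-intro live₀ (≡⇒== refl)
      d₁-at : dartsAt W v d₁ ≡ true
      d₁-at = ∧-intro (within-rev W d₀ live₀) (≡⇒== refl)

      head-u : ∀ d → N-u d ≡ true → (W ∖ u) (tail (rev d)) ≡ true
      head-u d h = head-in {W} (∧-projₗ h)

      -- The graph is simple, so a dart from v to u other than d₁ cannot exist.
      head-v : ∀ d → N-v d ≡ true → (W ∖ u) (tail (rev d)) ≡ true
      head-v d h = ∖-intro {P = W} (∧-projₗ (head-in {W} (∧-projₗ h)))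
        (λ e → ∖-≢ {P = dartsAt W v} h (dart-inj d d₁ (==⇒≡ (∧-projᵣ {within W d} (∧-projₗ h))) (trans e (cong tail (sym (rev-invol d₀))))))

      A B B′ : Matrix 8
      A = allowed N-u (forced φ u)
      B = allowed N-v (forced φ v)
      -- A colour of v is recorded as the colour of u in conflict with it, so that disjoint
      -- matchings of `A` and `B′` are compatible colours along uv.
      B′ i a = B i (τ u v a)

      4+N-u≤8 : 4 + count N-u ≤ 8
      4+N-u≤8 = +-monoʳ-≤ 4 (≤-pred (≤-trans (≤-reflexive (sym (count-∖ (dartsAt W u) d₀ d₀-at))) le-u))

      3+N-v≤8 : 3 + count N-v ≤ 8
      3+N-v≤8 = +-monoʳ-≤ 3 (≤-pred (≤-trans (≤-reflexive (sym (count-∖ (dartsAt W v) d₁ d₁-at))) le-v))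

      forced-u-injective : ∀ d → N-u d ≡ true → ∀ {i j} → forced φ u d i ≡ forced φ u d j → i ≡ j
      forced-u-injective d h e = injective pack _ (head-u d h) (τ-injective (head-adjacent {W} (∧-projₗ h)) e)

      forced-v-injective : ∀ d → N-v d ≡ true → ∀ {i j} → forced φ v d i ≡ forced φ v d j → i ≡ j
      forced-v-injective d h e = injective pack _ (head-v d h) (τ-injective (head-adjacent {W} (∧-projₗ h)) e)

      W∖u-v : (W ∖ u) v ≡ true
      W∖u-v = ∖-intro {P = W} Wv v≢u

      -- The colours of v in the packing of the smaller graph, the perfect matching that minimum
      -- degree 3 alone would not provide.
      current : PerfectMatching B′
      current = (λ i → τ v u (φ v i)) , (λ e → injective pack v W∖u-v (τ-injective v~u e)) ,
        (λ i → trans (cong (B i) (τ-inverse v~u (φ v i))) (allowed-intro (λ d h → compatible pack _ v (head-v d h) W∖u-v (head-adjacent {W} (∧-projₗ h)) i)))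

      MN : DisjointMatchings A B′
      MN = disjoint-matchings ≤-refl ≤-refl A B′ (allowed-rows 4 4+N-u≤8) (allowed-cols 4 4+N-u≤8 forced-u-injective)
        (λ i → ≤-trans (allowed-rows 3 3+N-v≤8 i) (≤-reflexive (sym (count-reindex (τ-injective u~v) (B i)))))
        (λ a → allowed-cols 3 3+N-v≤8 forced-v-injective (τ u v a)) current

      f g : Fin 8 → Fin 8
      f = proj₁ (proj₁ MN)
      g i = τ u v (proj₁ (proj₁ (proj₂ MN)) i)

      φ₁ : Colours
      φ₁ = recolour φ v g

      g-inj : ∀ {i j} → g i ≡ g j → i ≡ j
      g-inj e = proj₁ (proj₂ (proj₁ (proj₂ MN))) (τ-injective u~v e)

      compatible-v : ∀ w → W∖u∖v w ≡ true → Adj G w v → Compatible w v (φ w) g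
      compatible-v w h adjacent i with dart-to {W} Wv (∧-projₗ (∧-projₗ h)) (adjacent-sym adjacent)
      ... | d , at , refl = allowed-≢ (proj₂ (proj₂ (proj₁ (proj₂ MN))) i) d
              (∖-intro {P = dartsAt W v} at (λ e → ∖-≢ {P = W} (∧-projₗ h) (trans (cong (tail ∘ rev) e) (cong tail (rev-invol d₀)))))

      compatible-u : ∀ w → (W ∖ u) w ≡ true → Adj G w u → Compatible w u (φ₁ w) f
      compatible-u w h adjacent i with w Fin.≟ v
      ... | yes refl = λ e → proj₂ (proj₂ MN) i (sym (trans (sym (τ-inverse u~v _)) (trans (cong (λ c → τ v u (c i)) (sym (recolour-at φ v g))) e)))
      ... | no w≢v with dart-to {W} Wu (∧-projₗ h) (adjacent-sym adjacent)
      ...   | d , at , refl = λ e → allowed-≢ (proj₂ (proj₂ (proj₁ MN)) i) d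
              (∖-intro {P = dartsAt W u} at (λ q → w≢v (cong (tail ∘ rev) q)))
              (trans (cong (λ c → τ (tail (rev d)) u (c i)) (sym (recolour-off φ v g w≢v))) e)

    packing-on : ∀ k W → count W < k → Σ Colours (PackingOn W)
    packing-on (suc k) W (s≤s le) with search W
    ... | inj₂ none = (λ _ i → i) , record
          { injective = λ v w → ⊥-elim (false≢true (none v) w) ; compatible = λ v _ w → ⊥-elim (false≢true (none v) w) }
    ... | inj₁ (w , Ww) with light W w Ww
    ... | inj₁ (u , Wu , le-u) = extend-light-vertex u Wu le-u (proj₂ (packing-on k (W ∖ u) (≤-trans (≤-reflexive (sym (count-∖ W u Wu))) le)))
    -- Only u is removed from W: the smaller packing has to contain v for its colours to serve as
    -- the starting matching.
    ... | inj₂ (d , h , le-u , le-v) = extend-light-edge d h le-u le-v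
          (proj₂ (packing-on k (W ∖ tail d) (≤-trans (≤-reflexive (sym (count-∖ W (tail d) (∧-projₗ h)))) le)))

    packing : Packing G C
    packing = (λ i v → φ v i) , (λ i v w e q → compatible p v w refl refl (arc-adj v w e) i (trans (τ-arc e (φ v i)) q)) ,
      (λ v i j i≢j q → i≢j (injective p v refl q))
      where
      everything : Σ Colours (PackingOn (λ _ → true))
      everything = packing-on _ (λ _ → true) ≤-refl
      φ = proj₁ everything
      p = proj₂ everything

theorem1 : (G : Graph) → Planar G → χc⋆≤ G 8
theorem1 G P = 8 , s≤s z≤n , ≤-refl , Colouring.packing G P
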